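{- Let $m\ge 2$ and let $B$ be a set of edges of $CK(2m)$. Then $B$ is a blocker if and only if there exist an integer $a$, an integer $t$ with $2\le t\le m$, and integers $\epsilon_{t+1},\dots,\epsilon_m$ with $1\le \epsilon_{t+1}<\epsilon_{t+2}<\dots<\epsilon_m\le m-2$ (this list being empty when $t=m$) such that, with all vertex labels taken modulo $2m$, \[ B=\{[a+i-1,\,a+i]:1\le i\le t\}\ \cup\ \{[a+t+j-1-\epsilon_{t+j},\,a+t+j+\epsilon_{t+j}]:1\le j\le m-t\}. \] In particular every blocker is a crossing-free caterpillar tree whose spine is the boundary path $\langle a,a+1,\dots,a+t\rangle$ of length $t\ge 2$, and $t$ is the number of boundary edges of $B$.
   Context: $CK(2m)$ denotes the complete convex geometric graph whose vertices are the $2m$ vertices of a convex polygon, labelled cyclically $0,1,\dots,2m-1$ (labels taken modulo $2m$), and whose edges are all straight segments $[i,j]$ between pairs of vertices. Two edges with four distinct endpoints cross (meet in an interior point) iff their endpoints alternate in the cyclic order. A simple perfect matching (SPM) is a set of $m$ edges that are pairwise disjoint (no common endpoint and no crossing). A blocking set is a set of edges containing at least one edge of every SPM. A blocker is a blocking set with exactly $m$ edges. Boundary edges are the edges $[i,i+1]$. A caterpillar is a tree such that deleting all leaves and their incident edges leaves a path (or the empty graph); a spine is a longest path in it. -}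

module Defs where

open import Data.Fin using (Fin; fromℕ<; _<_)
open import Data.Integer using (ℤ; 1ℤ; +_; _+_; _-_)
open import Data.Integer.DivMod using (_%ℕ_; n%ℕd<d)
open import Data.List using (List; []; _∷_; _++_; _∷ʳ_; length; map; upTo)
import Data.List.Membership.Propositional as List
open import Data.List.Relation.Unary.All using (All)
open import Data.List.Relation.Unary.Linked using (Linked)
open import Data.List.Relation.Unary.Unique.Propositional using (Unique)
open import Data.Nat as ℕ using (ℕ; NonZero; suc; pred; _≤_; _∸_)
open import Data.Nat.Properties using (m*n≢0)
open import Data.Product using (∃₂; ∃!; ∃-syntax; _×_)
open import Data.Sum using (_⊎_)
open import Level using (0ℓ)
open import Relation.Binary.Construct.Closure.ReflexiveTransitive using (Star)
open import Relation.Binary.PropositionalEquality using (_≡_; _≢_)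
open import Relation.Nullary using (¬_)
open import Relation.Unary using (Pred; _∈_; _∉_; _≐_; _∩_; _∪_; _≬_)

private
  variable
    n : ℕ

-- A set is an arbitrary predicate; having k elements means being listed
-- without repetition by a list of length k.
HasSize : {A : Set} → Pred A 0ℓ → ℕ → Set
HasSize P k = ∃[ xs ] length xs ≡ k × Unique xs × P ≐ (List._∈ xs)

-- An edge is an unordered pair of distinct vertices, represented by its
-- endpoints in increasing order of label.
record Edge (n : ℕ) : Set where
  constructor edge
  field
    lo hi : Fin n
    lo<hi : lo < hi

open Edge public

-- The edge e is the segment [u , v] (equivalently [v , u]).
Joins : Edge n → Fin n → Fin n → Set
Joins e u v = (lo e ≡ u × hi e ≡ v) ⊎ (lo e ≡ v × hi e ≡ u)

Incident : Fin n → Edge n → Set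
Incident v e = v ≡ lo e ⊎ v ≡ hi e

-- The four endpoints are distinct and alternate in the cyclic order: read
-- from the smallest label on, they belong to e, f, e, f or to f, e, f, e.
Crosses : Edge n → Edge n → Set
Crosses e f = (lo e < lo f × lo f < hi e × hi e < hi f)
            ⊎ (lo f < lo e × lo e < hi f × hi f < hi e)

Disjoint : Edge n → Edge n → Set
Disjoint e f = (∀ v → ¬ (Incident v e × Incident v f)) × ¬ Crosses e f

CrossingFree : Pred (Edge n) 0ℓ → Set
CrossingFree B = ∀ e f → e ∈ B → f ∈ B → ¬ Crosses e f

IsSPM : (m : ℕ) → Pred (Edge (2 ℕ.* m)) 0ℓ → Set
IsSPM m M = HasSize M m × (∀ e f → e ∈ M → f ∈ M → e ≢ f → Disjoint e f)

IsBlocking : (m : ℕ) → Pred (Edge (2 ℕ.* m)) 0ℓ → Set₁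
IsBlocking m B = ∀ (M : Pred (Edge (2 ℕ.* m)) 0ℓ) → IsSPM m M → B ≬ M

IsBlocker : (m : ℕ) → Pred (Edge (2 ℕ.* m)) 0ℓ → Set₁
IsBlocker m B = IsBlocking m B × HasSize B m

module _ (m : ℕ) .{{_ : NonZero m}} where

  private
    instance
      2m≢0 : NonZero (2 ℕ.* m)
      2m≢0 = m*n≢0 2 m

  -- The vertex labelled by an integer taken modulo 2m.
  vertex : ℤ → Fin (2 ℕ.* m)
  vertex z = fromℕ< (n%ℕd<d z (2 ℕ.* m))

  IsBoundary : Pred (Edge (2 ℕ.* m)) 0ℓ
  IsBoundary e = ∃[ i ] Joins e (vertex i) (vertex (i + 1ℤ))

  boundaryPath : ℤ → ℕ → List (Fin (2 ℕ.* m))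
  boundaryPath a t = map (λ i → vertex (a + + i)) (upTo (suc t))

  spineEdges : ℤ → ℕ → Pred (Edge (2 ℕ.* m)) 0ℓ
  spineEdges a t e = ∃[ i ] 1 ≤ i × i ≤ t ×
    Joins e (vertex (a + + i - 1ℤ)) (vertex (a + + i))

  legEdges : ℤ → ℕ → (ℕ → ℕ) → Pred (Edge (2 ℕ.* m)) 0ℓ
  legEdges a t ε e = ∃[ j ] 1 ≤ j × j ≤ m ∸ t ×
    Joins e (vertex (a + + t + + j - 1ℤ - + ε (t ℕ.+ j)))
            (vertex (a + + t + + j + + ε (t ℕ.+ j)))

-- 2 ≤ t ≤ m and 1 ≤ ε (t+1) < ε (t+2) < … < ε m ≤ m - 2.  The values of ε
-- outside the indices t+1, …, m are irrelevant.
Admissible : ℕ → ℕ → (ℕ → ℕ) → Set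
Admissible m t ε =
  2 ≤ t × t ≤ m ×
  (∀ k → t ℕ.< k → k ≤ m → 1 ≤ ε k × ε k ≤ m ∸ 2) ×
  (∀ k → t ℕ.< k → k ℕ.< m → ε k ℕ.< ε (suc k))

HasForm : (m : ℕ) .{{_ : NonZero m}} →
          Pred (Edge (2 ℕ.* m)) 0ℓ → ℤ → ℕ → (ℕ → ℕ) → Set
HasForm m B a t ε =
  Admissible m t ε × B ≐ (spineEdges m a t ∪ legEdges m a t ε)

record Graph (n : ℕ) : Set₁ where
  constructor graph
  field
    verts : Pred (Fin n) 0ℓ
    edges : Pred (Edge n) 0ℓ

open Graph public

-- A set of edges, as a graph on the endpoints of its edges.
⟦_⟧ : Pred (Edge n) 0ℓ → Graph n
⟦ B ⟧ = graph (λ v → ∃[ e ] e ∈ B × Incident v e) B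

Adj : Graph n → Fin n → Fin n → Set
Adj G u v = ∃[ e ] e ∈ edges G × Joins e u v

IsPath : Graph n → List (Fin n) → Set
IsPath G vs = vs ≢ [] × All (_∈ verts G) vs × Unique vs × Linked (Adj G) vs

pathLength : List (Fin n) → ℕ
pathLength vs = pred (length vs)

IsConnected : Graph n → Set
IsConnected G = ∀ u v → u ∈ verts G → v ∈ verts G → Star (Adj G) u v

-- The cycle v, vs₁, …, vsₖ, v has k + 1 ≥ 3 distinct vertices.
IsAcyclic : Graph n → Set
IsAcyclic G = ∀ v vs → 2 ≤ length vs → Unique (v ∷ vs) →
              ¬ Linked (Adj G) (v ∷ vs ∷ʳ v)

IsTree : Graph n → Set
IsTree G = (∃[ v ] v ∈ verts G) × IsConnected G × IsAcyclic G

IsLeaf : Graph n → Pred (Fin n) 0ℓ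
IsLeaf G v = v ∈ verts G × ∃! _≡_ (λ e → e ∈ edges G × Incident v e)

pruneLeaves : Graph n → Graph n
pruneLeaves G = graph
  (λ v → v ∈ verts G × v ∉ IsLeaf G)
  (λ e → e ∈ edges G × (∀ v → Incident v e → v ∉ IsLeaf G))

-- The list vs may be empty, in which case G is the empty graph.
IsPathOrEmptyGraph : Graph n → Set
IsPathOrEmptyGraph G = ∃[ vs ]
  Unique vs ×
  verts G ≐ (List._∈ vs) ×
  edges G ≐ (λ e → ∃₂ λ us ws → ∃₂ λ u w →
               vs ≡ us ++ u ∷ w ∷ ws × Joins e u w)

IsCaterpillar : Graph n → Set
IsCaterpillar G = IsTree G × IsPathOrEmptyGraph (pruneLeaves G)

IsSpine : Graph n → List (Fin n) → Set
IsSpine G vs = IsPath G vs ×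
               (∀ ws → IsPath G ws → pathLength ws ≤ pathLength vs)

{-# OPTIONS --safe #-}

-- Every edge of odd span is a segment [c - j, c + 1 + j] with centre c and
-- radius j < m; edges with the same centre are parallel, and the centres c and
-- c + m describe the same edges, with radii j and m - 1 - j.
--
-- The m edges of one direction form a simple perfect matching, so a blocker B
-- has exactly one edge with each centre c, of radius ε(c) say.  The other
-- matchings needed consist of a boundary edge and two further arcs of nested
-- parallel edges.  As they meet B, a value r with ε(c) ≤ r ≤ ε(c + 1) forces
-- ε(c - r) = 0, and one with ε(c + 1) ≤ r ≤ ε(c) forces ε(c + 1 + r) = 0.
-- Take a zero p of ε and a place q > p with ε(q) = m - 1, with no value 0 or
-- m - 1 in between.  By the first rule and a discrete intermediate value
-- argument all of q - m, …, p are zeros, and by the second rule ε strictly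
-- increases on p, …, q: this is the required form, starting at a = q - m.
--
-- Conversely let a matching avoid a set B of this form, with a = 0.  Start with
-- the chord {t - 1, t} and move to {x - 1, y + 1} or to {x, y + 2} until
-- {0, 2m - 1} is reached, making the second kind of move precisely when it ends
-- at an edge of B.  The partner of x then never lies between x and y, because
-- partners have odd distance and edges do not cross, which is absurd at the end.
--
-- Ordered by their labels from a on, all vertices have at most one smaller
-- neighbour, whence B has no cycles; the vertices a + 1, …, a + t - 1 are
-- those that are not leaves, and they bound the length of paths.

module Submission where

-- Linear arithmetic over the natural numbers

module LinearArithmetic where

  open import Data.Bool using (Bool; true; false; T; _∧_; _∨_)
  open import Data.Bool.Properties using (T-∧; T-∨)
  open import Data.Fin using (Fin)
  open import Data.List using (List; []; _∷_; _++_; map)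
  open import Data.List.Relation.Unary.All as All using (All; []; _∷_)
  open import Data.List.Relation.Unary.All.Properties using (++⁺; map⁺)
  open import Data.Nat
  open import Data.Nat.Properties
  open import Data.Product using (_×_; _,_)
  open import Data.Sum using (inj₁; inj₂)
  open import Data.Empty using (⊥; ⊥-elim)
  open import Data.Vec as Vec using (Vec; []; _∷_; lookup; zipWith; allFin)
  open import Data.Vec.N-ary using (N-ary; _$ⁿ_; ∀ⁿ; curryⁿ)
  open import Function using (Equivalence)
  open import Relation.Binary.PropositionalEquality
  open import Relation.Nullary using (yes; no)

  infixl 7 _:+_
  infix 8 #_
  infix 6 _:≤_ _:<_ _:≡_
  infix 3 _⊢_

  data Term (k : ℕ) : Set where
    var  : Fin k → Term k
    #_   : ℕ → Term k
    _:+_ : Term k → Term k → Term k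

  data Atom (k : ℕ) : Set where
    _:≤_ _:≡_ : Term k → Term k → Atom k
    :⊥        : Atom k

  -- Its meaning reduces to `suc ⟦ s ⟧ₜ ≤ ⟦ t ⟧ₜ`, which is `<` on the natural numbers by
  -- definition, so strict hypotheses can be passed on unchanged.
  _:<_ : ∀ {k} → Term k → Term k → Atom k
  s :< t = # 1 :+ s :≤ t

  data Sequent (k : ℕ) : Set where
    _⊢_ : List (Atom k) → Atom k → Sequent k

  module _ {k : ℕ} where

    ⟦_⟧ₜ : Term k → Vec ℕ k → ℕ
    ⟦ var i ⟧ₜ  ρ = lookup ρ i
    ⟦ # c ⟧ₜ    ρ = c
    ⟦ s :+ t ⟧ₜ ρ = ⟦ s ⟧ₜ ρ + ⟦ t ⟧ₜ ρ

    ⟦_⟧ₐ : Atom k → Vec ℕ k → Set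
    ⟦ s :≤ t ⟧ₐ ρ = ⟦ s ⟧ₜ ρ ≤ ⟦ t ⟧ₜ ρ
    ⟦ s :≡ t ⟧ₐ ρ = ⟦ s ⟧ₜ ρ ≡ ⟦ t ⟧ₜ ρ
    ⟦ :⊥ ⟧ₐ     ρ = ⊥

    ⟦_⟧ : Sequent k → Vec ℕ k → Set
    ⟦ []     ⊢ g ⟧ ρ = ⟦ g ⟧ₐ ρ
    ⟦ a ∷ as ⊢ g ⟧ ρ = ⟦ a ⟧ₐ ρ → ⟦ as ⊢ g ⟧ ρ

    -- Coefficients of a linear form; the constant is that of a further
    -- variable with value 1.
    Form : Set
    Form = Vec ℕ (suc k)

  dot : ∀ {k} → Vec ℕ k → Vec ℕ k → ℕ
  dot []       []      = 0
  dot (c ∷ cs) (x ∷ ρ) = c * x + dot cs ρ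

  zeros : ∀ k → Vec ℕ k
  zeros k = Vec.replicate k 0

  unit : ∀ {k} → Fin k → Vec ℕ k
  unit Fin.zero    = 1 ∷ zeros _
  unit (Fin.suc i) = 0 ∷ unit i

  _⊞_ : ∀ {k} → Vec ℕ k → Vec ℕ k → Vec ℕ k
  _⊞_ = zipWith _+_

  _≤ᵛ_ : ∀ {k} → Vec ℕ k → Vec ℕ k → Bool
  []       ≤ᵛ []       = true
  (c ∷ cs) ≤ᵛ (d ∷ ds) = (c ≤ᵇ d) ∧ (cs ≤ᵛ ds)

  dot-zeros : ∀ {k} (ρ : Vec ℕ k) → dot (zeros k) ρ ≡ 0
  dot-zeros []      = refl
  dot-zeros (x ∷ ρ) = dot-zeros ρ

  dot-unit : ∀ {k} (i : Fin k) (ρ : Vec ℕ k) → dot (unit i) ρ ≡ lookup ρ i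
  dot-unit Fin.zero (x ∷ ρ) = trans (cong₂ _+_ (+-identityʳ x) (dot-zeros ρ)) (+-identityʳ x)
  dot-unit (Fin.suc i) (x ∷ ρ) = dot-unit i ρ

  +-exchange : ∀ a b c d → (a + b) + (c + d) ≡ (a + c) + (b + d)
  +-exchange a b c d = begin
    (a + b) + (c + d) ≡⟨ +-assoc a b (c + d) ⟩
    a + (b + (c + d)) ≡⟨ cong (a +_) (+-assoc b c d) ⟨
    a + (b + c + d)   ≡⟨ cong (λ z → a + (z + d)) (+-comm b c) ⟩
    a + (c + b + d)   ≡⟨ cong (a +_) (+-assoc c b d) ⟩
    a + (c + (b + d)) ≡⟨ +-assoc a c (b + d) ⟨
    (a + c) + (b + d) ∎
    where open ≡-Reasoning

  dot-⊞ : ∀ {k} (cs ds ρ : Vec ℕ k) → dot (cs ⊞ ds) ρ ≡ dot cs ρ + dot ds ρ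
  dot-⊞ []       []       []      = refl
  dot-⊞ (c ∷ cs) (d ∷ ds) (x ∷ ρ) =
    trans (cong₂ _+_ (*-distribʳ-+ x c d) (dot-⊞ cs ds ρ))
          (+-exchange (c * x) (d * x) (dot cs ρ) (dot ds ρ))

  dot-mono : ∀ {k} (cs ds ρ : Vec ℕ k) → T (cs ≤ᵛ ds) → dot cs ρ ≤ dot ds ρ
  dot-mono []       []       []      _ = z≤n
  dot-mono (c ∷ cs) (d ∷ ds) (x ∷ ρ) p with Equivalence.to T-∧ p
  ... | c≤d , cs≤ds = +-mono-≤ (*-monoˡ-≤ x (≤ᵇ⇒≤ c d c≤d)) (dot-mono cs ds ρ cs≤ds)

  module _ {k : ℕ} where

    form : Term k → Form
    form (var i)  = 0 ∷ unit i
    form (# c)    = c ∷ zeros k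
    form (s :+ t) = form s ⊞ form t

    form-correct : ∀ t ρ → dot (form t) (1 ∷ ρ) ≡ ⟦ t ⟧ₜ ρ
    form-correct (var i)  ρ = dot-unit i ρ
    form-correct (# c)    ρ =
      trans (cong₂ _+_ (*-identityʳ c) (dot-zeros ρ)) (+-identityʳ c)
    form-correct (s :+ t) ρ =
      trans (dot-⊞ (form s) (form t) (1 ∷ ρ))
            (cong₂ _+_ (form-correct s ρ) (form-correct t ρ))

    Ineq : Set
    Ineq = Form {k} × Form {k}

    Holds : Vec ℕ k → Ineq → Set
    Holds ρ (l , r) = dot l (1 ∷ ρ) ≤ dot r (1 ∷ ρ)

    _⊕_ : Ineq → Ineq → Ineq
    (l , r) ⊕ (l′ , r′) = l ⊞ l′ , r ⊞ r′

    ⊕-holds : ∀ ρ a b → Holds ρ a → Holds ρ b → Holds ρ (a ⊕ b)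
    ⊕-holds ρ (l , r) (l′ , r′) p q
      rewrite dot-⊞ l l′ (1 ∷ ρ) | dot-⊞ r r′ (1 ∷ ρ) = +-mono-≤ p q

    one : Form
    one = 1 ∷ zeros k

    Holding : Vec ℕ k → List Ineq → Set
    Holding ρ = All (Holds ρ)

    mutual

      -- Some choice of one inequality from each list adds up to an inequality
      -- l ≤ r with r + 1 ≤ l coefficientwise.
      refutes : Ineq → List (List Ineq) → Bool
      refutes (l , r) []         = (one ⊞ r) ≤ᵛ l
      refutes a       (cs ∷ css) = refutes-one a cs css

      refutes-one : Ineq → List Ineq → List (List Ineq) → Bool
      refutes-one a []       css = false
      refutes-one a (c ∷ cs) css = refutes (a ⊕ c) css ∨ refutes-one a cs css

    mutual

      refutes-sound : ∀ ρ a css → T (refutes a css) → Holds ρ a → All (Holding ρ) css → ⊥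
      refutes-sound ρ (l , r) [] c p [] = 1+n≰n (begin
        suc (dot r (1 ∷ ρ))             ≡⟨ cong (_+ dot r (1 ∷ ρ)) (cong suc (dot-zeros ρ)) ⟨
        dot one (1 ∷ ρ) + dot r (1 ∷ ρ) ≡⟨ dot-⊞ one r (1 ∷ ρ) ⟨
        dot (one ⊞ r) (1 ∷ ρ)           ≤⟨ dot-mono (one ⊞ r) l (1 ∷ ρ) c ⟩
        dot l (1 ∷ ρ)                   ≤⟨ p ⟩
        dot r (1 ∷ ρ)                   ∎)
        where open ≤-Reasoning
      refutes-sound ρ a (cs ∷ css) c p (qs ∷ qss) = refutes-one-sound ρ a cs css c p qs qss

      refutes-one-sound : ∀ ρ a cs css → T (refutes-one a cs css) → Holds ρ a →
        Holding ρ cs → All (Holding ρ) css → ⊥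
      refutes-one-sound ρ a (c ∷ cs) css t p (q ∷ qs) qss with Equivalence.to
        (T-∨ {refutes (a ⊕ c) css}) t
      ... | inj₁ t₁ = refutes-sound ρ (a ⊕ c) css t₁ (⊕-holds ρ a c p q) qss
      ... | inj₂ t₂ = refutes-one-sound ρ a cs css t₂ p qs qss

    ineq : Term k → Term k → Ineq
    ineq s t = form s , form t

    holds : ∀ {ρ} s t → ⟦ s ⟧ₜ ρ ≤ ⟦ t ⟧ₜ ρ → Holds ρ (ineq s t)
    holds {ρ} s t p rewrite form-correct s ρ | form-correct t ρ = p

    trivial : Ineq
    trivial = ineq (# 0) (# 0)

    trivial-holds : ∀ {ρ} → Holds ρ trivial
    trivial-holds {ρ} = holds {ρ} (# 0) (# 0) z≤n

    -- How often an inequality may be used: once at level 0, at most once at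
    -- level 1 and at most twice at level 2.
    multiples : ℕ → Ineq → List Ineq
    multiples 0             h = h ∷ []
    multiples 1             h = h ∷ trivial ∷ []
    multiples (suc (suc _)) h = h ∷ trivial ∷ h ⊕ h ∷ []

    multiples-hold : ∀ {ρ} i {h} → Holds ρ h → Holding ρ (multiples i h)
    multiples-hold     0             p     = p ∷ []
    multiples-hold {ρ} 1             p     = p ∷ trivial-holds {ρ} ∷ []
    multiples-hold {ρ} (suc (suc _)) {h} p = p ∷ trivial-holds {ρ} ∷ ⊕-holds ρ h h p p ∷ []

    -- An equation offers both of its directions, but one search uses only one of them.
    choices : ℕ → Atom k → List Ineq
    choices i (s :≤ t) = multiples i (ineq s t)
    choices i (s :≡ t) = multiples i (ineq s t) ++ multiples i (ineq t s)
    choices i :⊥       = []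

    choices-hold : ∀ {ρ} i a → ⟦ a ⟧ₐ ρ → Holding ρ (choices i a)
    choices-hold i (s :≤ t) p = multiples-hold i (holds s t p)
    choices-hold i (s :≡ t) p = ++⁺ (multiples-hold i (holds s t (≤-reflexive p)))
                                    (multiples-hold i (holds t s (≤-reflexive (sym p))))

    search : ℕ → List (Atom k) → Bool
    search i as = refutes trivial (map (choices i) as)

    Facts : Vec ℕ k → List (Atom k) → Set
    Facts ρ = All (λ a → ⟦ a ⟧ₐ ρ)

    search-sound : ∀ {ρ} i as → T (search i as) → Facts ρ as → ⊥
    search-sound {ρ} i as c ps =
      refutes-sound ρ trivial _ c (trivial-holds {ρ})
        (map⁺ (All.map (λ {a} → choices-hold i a) ps))

    -- The levels come in order of increasing cost: at level 0 every hypothesis takes part once, and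
    -- only the directions of equations are searched.
    refute : List (Atom k) → Bool
    refute as = search 0 as ∨ (search 1 as ∨ search 2 as)

    refute-sound : ∀ {ρ} as → T (refute as) → Facts ρ as → ⊥
    refute-sound as c ps with Equivalence.to (T-∨ {search 0 as}) c
    ... | inj₁ c₀ = search-sound 0 as c₀ ps
    ... | inj₂ c′ with Equivalence.to (T-∨ {search 1 as}) c′
    ...   | inj₁ c₁ = search-sound 1 as c₁ ps
    ...   | inj₂ c₂ = search-sound 2 as c₂ ps

    check : Sequent k → Bool
    check (as ⊢ s :≤ t) = refute (t :< s ∷ as)
    check (as ⊢ s :≡ t) = refute (t :< s ∷ as) ∧ refute (s :< t ∷ as)
    check (as ⊢ :⊥)     = refute as

    check-≤ : ∀ {ρ} as s t → T (refute (t :< s ∷ as)) → Facts ρ as → ⟦ s ⟧ₜ ρ ≤ ⟦ t ⟧ₜ ρ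
    check-≤ {ρ} as s t c ps with ⟦ s ⟧ₜ ρ ≤? ⟦ t ⟧ₜ ρ
    ... | yes p = p
    ... | no ¬p = ⊥-elim (refute-sound (t :< s ∷ as) c (≰⇒> ¬p ∷ ps))

    check-facts : ∀ {ρ} as g → T (check (as ⊢ g)) → Facts ρ as → ⟦ g ⟧ₐ ρ
    check-facts as (s :≤ t) c ps = check-≤ as s t c ps
    check-facts as (s :≡ t) c ps with Equivalence.to (T-∧ {refute (t :< s ∷ as)}) c
    ... | c₁ , c₂ = ≤-antisym (check-≤ as s t c₁ ps) (check-≤ as t s c₂ ps)
    check-facts as :⊥       c ps = refute-sound as c ps

    curry-facts : ∀ {ρ} as g → (Facts ρ as → ⟦ g ⟧ₐ ρ) → ⟦ as ⊢ g ⟧ ρ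
    curry-facts []       g f   = f []
    curry-facts (a ∷ as) g f p = curry-facts as g (λ ps → f (p ∷ ps))

    check-sound : ∀ ρ s → T (check s) → ⟦ s ⟧ ρ
    check-sound ρ (as ⊢ g) c = curry-facts as g (check-facts as g c)

  sequent : ∀ k → N-ary k (Term k) (Sequent k) → Sequent k
  sequent k f = f $ⁿ Vec.map var (allFin k)

  abstract

    -- linear k (λ x₁ … x_k → hypotheses ⊢ goal) proves the sequent for all values
    -- of the variables, by adding up the hypotheses and the negated goal.
    linear : ∀ k (f : N-ary k (Term k) (Sequent k)) {_ : T (check (sequent k f))} →
             ∀ⁿ k (curryⁿ ⟦ sequent k f ⟧)
    linear k f {c} = go k _ (λ ρ → check-sound ρ (sequent k f) c)
      where
      go : ∀ k (P : Vec ℕ k → Set) → (∀ ρ → P ρ) → ∀ⁿ k (curryⁿ P)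
      go zero    P p = p []
      go (suc k) P p = λ x → go k (λ ρ → P (x ∷ ρ)) (λ ρ → p (x ∷ ρ))

open import Defs
open import Data.Empty using (⊥; ⊥-elim)
open import Data.Fin as Fin using (Fin; toℕ; fromℕ<)
open import Data.Fin.Properties
  using (injective⇒≤; toℕ<n; toℕ-fromℕ<; toℕ-injective)
open import Data.Integer as ℤ using (ℤ; +_; -[1+_]; 1ℤ; _%ℕ_; _/ℕ_)
open import Data.Integer.DivMod using (n%ℕd<d; a≡a%ℕn+[a/ℕn]*n)
import Data.Integer.Properties as ℤ
open import Data.Integer.Tactic.RingSolver using (solve-∀)
open import Data.List
  using (List; []; _∷_; _++_; _∷ʳ_; length; lookup; map; allFin; tabulate; applyUpTo; upTo)
import Data.List.Membership.DecPropositional as DecMembership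
open import Data.List.Membership.Propositional using (_∈_; find; lose)
open import Data.List.Membership.Propositional.Properties
  using (∈-allFin; ∈-applyUpTo⁺; ∈-applyUpTo⁻; ∈-lookup; ∈-tabulate⁺; ∈-tabulate⁻; ∈-++⁺ʳ; ∈-++⁻)
open import Data.List.Properties
  using (∷-injective; length-++; length-applyUpTo; length-tabulate; map-cong; map-upTo)
open import Data.List.Relation.Unary.All as All using (All; []; _∷_)
import Data.List.Relation.Unary.All.Properties as All
open import Data.List.Relation.Unary.AllPairs as AllPairs using (AllPairs; []; _∷_)
import Data.List.Relation.Unary.AllPairs.Properties as AllPairs
open import Data.List.Relation.Unary.Any using (here; there; any?; index)
open import Data.List.Relation.Unary.Any.Properties using (lookup-index)
open import Data.List.Relation.Unary.Linked using (Linked; []; [-]; _∷_)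
import Data.List.Relation.Unary.Linked.Properties as Linked
open import Data.List.Relation.Unary.Unique.Propositional using (Unique)
import Data.List.Relation.Unary.Unique.Propositional.Properties as Unique
open import Data.Nat
  using (ℕ; NonZero; >-nonZero; zero; suc; pred; _+_; _*_; _∸_; _≤_; _<_; z≤n; s≤s; _≟_; _<?_; _≤?_)
open import Data.Nat.DivMod
open import Data.Nat.Properties hiding (_≟_; _<?_; _≤?_)
open import Data.Product using (∃; ∃₂; ∃-syntax; _×_; _,_; proj₁; proj₂)
open import Data.Sum using (_⊎_; inj₁; inj₂; [_,_]′; swap)
open import Data.Unit using (⊤; tt)
open import Function.Bundles using (_⇔_; mk⇔)
open import Level using (0ℓ)
open import Relation.Binary.Construct.Closure.ReflexiveTransitive as Star
  using (Star; _◅_; _◅◅_)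
open import Relation.Binary.Definitions using (DecidableEquality; tri<; tri≈; tri>)
open import Relation.Binary.PropositionalEquality
open import Relation.Nullary using (¬_; Dec; yes; no; contradiction)
open import Relation.Nullary.Decidable using (map′; _×-dec_; _⊎-dec_)
open import Relation.Unary as U using (Pred; _∩_; _≐_)
open LinearArithmetic using (linear; #_; _:+_; _:≤_; _:<_; _:≡_; :⊥; _⊢_)

-- Crossing edges and rotations of the labels

edge-≡ : ∀ {n} {e f : Edge n} → lo e ≡ lo f → hi e ≡ hi f → e ≡ f
edge-≡ {e = edge a b p} {edge .a .b q} refl refl = cong (edge a b) (≤-irrelevant p q)

infix 4 _≟ₑ_

_≟ₑ_ : ∀ {n} → DecidableEquality (Edge n)
e ≟ₑ f = map′ (λ (p , q) → edge-≡ p q) (λ { refl → refl , refl })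
              ((lo e Fin.≟ lo f) ×-dec (hi e Fin.≟ hi f))

joins-sym : ∀ {n} (e : Edge n) {u v} → Joins e u v → Joins e v u
joins-sym e = swap

joins-ends : ∀ {n} (e : Edge n) {u v u′ v′} → Joins e u v → Joins e u′ v′ →
             (u ≡ u′ × v ≡ v′) ⊎ (u ≡ v′ × v ≡ u′)
joins-ends e (inj₁ (refl , refl)) (inj₁ (refl , refl)) = inj₁ (refl , refl)
joins-ends e (inj₁ (refl , refl)) (inj₂ (refl , refl)) = inj₂ (refl , refl)
joins-ends e (inj₂ (refl , refl)) (inj₁ (refl , refl)) = inj₂ (refl , refl)
joins-ends e (inj₂ (refl , refl)) (inj₂ (refl , refl)) = inj₁ (refl , refl)

joins-unique : ∀ {n} (e f : Edge n) {u v} → Joins e u v → Joins f u v → e ≡ f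
joins-unique e f (inj₁ (p , q)) (inj₁ (p′ , q′)) = edge-≡ (trans p (sym p′)) (trans q (sym q′))
joins-unique e f (inj₂ (p , q)) (inj₂ (p′ , q′)) = edge-≡ (trans p (sym p′)) (trans q (sym q′))
joins-unique e f (inj₁ (refl , refl)) (inj₂ (refl , refl)) =
  contradiction (lo<hi e) (<-asym (lo<hi f))
joins-unique e f (inj₂ (refl , refl)) (inj₁ (refl , refl)) =
  contradiction (lo<hi e) (<-asym (lo<hi f))

joins-≢ : ∀ {n} (e : Edge n) {u v} → Joins e u v → u ≢ v
joins-≢ e (inj₁ (p , q)) refl = <-irrefl (cong toℕ (trans p (sym q))) (lo<hi e)
joins-≢ e (inj₂ (p , q)) refl = <-irrefl (cong toℕ (trans p (sym q))) (lo<hi e)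

join : ∀ {n} {u v : Fin n} → u ≢ v → ∃[ e ] Joins e u v
join {u = u} {v} u≢v with <-cmp (toℕ u) (toℕ v)
... | tri< u<v _ _ = edge u v u<v , inj₁ (refl , refl)
... | tri≈ _ u≡v _ = contradiction (toℕ-injective u≡v) u≢v
... | tri> _ _ v<u = edge v u v<u , inj₂ (refl , refl)

joins-incident : ∀ {n} (e : Edge n) {u v} → Joins e u v → Incident u e
joins-incident e (inj₁ (p , q)) = inj₁ (sym p)
joins-incident e (inj₂ (p , q)) = inj₂ (sym q)

incident-joins : ∀ {n} (e : Edge n) {u v w} → Joins e u v → Incident w e → w ≡ u ⊎ w ≡ v
incident-joins e (inj₁ (refl , refl)) i        = i
incident-joins e (inj₂ (refl , refl)) (inj₁ p) = inj₂ p
incident-joins e (inj₂ (refl , refl)) (inj₂ p) = inj₁ p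

disjoint-sym : ∀ {n} (e f : Edge n) → Disjoint e f → Disjoint f e
disjoint-sym e f (d , c) = (λ v (p , q) → d v (q , p)) , λ x → c (swap x)

-- The labels a, b, c, d are met in this order on the circle.
Cyclic : ℕ → ℕ → ℕ → ℕ → Set
Cyclic a b c d = (a < b × b < c × c < d) ⊎ (b < c × c < d × d < a) ⊎
                 (c < d × d < a × a < b) ⊎ (d < a × a < b × b < c)

cyclic-rotate : ∀ {a b c d} → Cyclic a b c d → Cyclic b c d a
cyclic-rotate (inj₁ (p , q , r))                = inj₂ (inj₂ (inj₂ (p , q , r)))
cyclic-rotate (inj₂ (inj₁ (p , q , r)))         = inj₁ (p , q , r)
cyclic-rotate (inj₂ (inj₂ (inj₁ (p , q , r))))  = inj₂ (inj₁ (p , q , r))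
cyclic-rotate (inj₂ (inj₂ (inj₂ (p , q , r))))  = inj₂ (inj₂ (inj₁ (p , q , r)))

Interlaced : ℕ → ℕ → ℕ → ℕ → Set
Interlaced a b c d = (a < c × c < b × b < d) ⊎ (c < a × a < d × d < b)

-- The chords {a, b} and {c, d} cross.
Cross : ℕ → ℕ → ℕ → ℕ → Set
Cross a b c d = Cyclic a c b d ⊎ Cyclic a d b c

cross-swapˡ : ∀ {a b c d} → Cross a b c d → Cross b a c d
cross-swapˡ (inj₁ p) = inj₂ (cyclic-rotate (cyclic-rotate p))
cross-swapˡ (inj₂ p) = inj₁ (cyclic-rotate (cyclic-rotate p))

cross-swapʳ : ∀ {a b c d} → Cross a b c d → Cross a b d c
cross-swapʳ = swap

cyclic⇒interlaced : ∀ {a b c d} → a < b → c < d → Cyclic a c b d → Interlaced a b c d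
cyclic⇒interlaced a<b c<d (inj₁ p) = inj₁ p
cyclic⇒interlaced a<b c<d (inj₂ (inj₁ (p , q , r))) = contradiction a<b (<-asym (<-trans q r))
cyclic⇒interlaced a<b c<d (inj₂ (inj₂ (inj₁ (p , q , r)))) =
  contradiction a<b (<-asym (<-trans p q))
cyclic⇒interlaced a<b c<d (inj₂ (inj₂ (inj₂ (p , q , r)))) =
  contradiction c<d (<-asym (<-trans p q))

cyclic⇒interlaced′ : ∀ {a b c d} → a < b → c < d → Cyclic a d b c → Interlaced a b c d
cyclic⇒interlaced′ a<b c<d (inj₁ (p , q , r)) = contradiction c<d (<-asym (<-trans q r))
cyclic⇒interlaced′ a<b c<d (inj₂ (inj₁ (p , q , r))) = contradiction a<b (<-asym (<-trans q r))
cyclic⇒interlaced′ a<b c<d (inj₂ (inj₂ (inj₁ (p , q , r)))) =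
  contradiction a<b (<-asym (<-trans p q))
cyclic⇒interlaced′ a<b c<d (inj₂ (inj₂ (inj₂ p))) = inj₂ p

cross⇒interlaced : ∀ {a b c d} → a < b → c < d → Cross a b c d → Interlaced a b c d
cross⇒interlaced a<b c<d = [ cyclic⇒interlaced a<b c<d , cyclic⇒interlaced′ a<b c<d ]′

module Rotation (n : ℕ) .{{_ : NonZero n}} where

  -- One unit at a time moves from `s` to the four labels. When the largest label reaches `n` it
  -- wraps to 0 and becomes the first one, which is a cyclic rotation.
  cyclic-rotation : ∀ s {a b c d} → a < b → b < c → c < d → d < n →
    Cyclic ((s + a) % n) ((s + b) % n) ((s + c) % n) ((s + d) % n)
  cyclic-rotation zero {a} {b} {c} {d} a<b b<c c<d d<n
    rewrite m<n⇒m%n≡m d<n | m<n⇒m%n≡m (<-trans c<d d<n)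
          | m<n⇒m%n≡m (<-trans b<c (<-trans c<d d<n))
          | m<n⇒m%n≡m (<-trans a<b (<-trans b<c (<-trans c<d d<n))) = inj₁ (a<b , b<c , c<d)
  cyclic-rotation (suc s) {a} {b} {c} {d} a<b b<c c<d d<n
    rewrite sym (+-suc s a) | sym (+-suc s b) | sym (+-suc s c) | sym (+-suc s d)
    with m≤n⇒m<n∨m≡n d<n
  ... | inj₁ d+1<n = cyclic-rotation s (s≤s a<b) (s≤s b<c) (s≤s c<d) d+1<n
  ... | inj₂ d+1≡n =
    subst (Cyclic ((s + suc a) % n) ((s + suc b) % n) ((s + suc c) % n)) (sym wrap)
      (cyclic-rotate (cyclic-rotation s (s≤s z≤n) (s≤s a<b) (s≤s b<c)
        (subst (suc (suc c) ≤_) d+1≡n (s≤s c<d))))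
    where
    wrap : (s + suc d) % n ≡ (s + 0) % n
    wrap = trans (cong (λ z → (s + z) % n) d+1≡n)
      (trans ([m+n]%n≡m%n s n) (cong (_% n) (sym (+-identityʳ s))))

  cross-rotation : ∀ s {a b c d} → a < n → b < n → c < n → d < n → Interlaced a b c d →
    Cross ((s + a) % n) ((s + b) % n) ((s + c) % n) ((s + d) % n)
  cross-rotation s a< b< c< d< (inj₁ (p , q , r)) = inj₁ (cyclic-rotation s p q r d<)
  cross-rotation s a< b< c< d< (inj₂ (p , q , r)) =
    inj₂ (cyclic-rotate (cyclic-rotation s p q r b<))

  V : ℕ → Fin n
  V i = fromℕ< (m%n<n i n)

  toℕ-V : ∀ i → toℕ (V i) ≡ i % n
  toℕ-V i = toℕ-fromℕ< _

  V-cong : ∀ {i j} → i % n ≡ j % n → V i ≡ V j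
  V-cong {i} {j} p = toℕ-injective (trans (toℕ-V i) (trans p (sym (toℕ-V j))))

  V-cancel : ∀ {i j} → V i ≡ V j → i % n ≡ j % n
  V-cancel {i} {j} p = trans (sym (toℕ-V i)) (trans (cong toℕ p) (toℕ-V j))

  V-period : ∀ i → V (i + n) ≡ V i
  V-period i = V-cong ([m+n]%n≡m%n i n)

  -- The label of a vertex when the labels start at the vertex s.
  pos : ℕ → Fin n → ℕ
  pos s v = ((n ∸ s % n) + toℕ v) % n

  pos<n : ∀ s v → pos s v < n
  pos<n s v = m%n<n _ n

  private
    -- `n ∸ s % n` is the inverse of `s` modulo `n`.
    complement : ∀ s i → ((n ∸ s % n) + (s + i)) % n ≡ i % n
    complement s i = begin
      ((n ∸ s % n) + (s + i)) % n            ≡⟨ cong (_% n) (+-assoc (n ∸ s % n) s i) ⟨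
      ((n ∸ s % n) + s + i) % n              ≡⟨ cong (λ z → (z + i) % n) multiple ⟩
      (n + s / n * n + i) % n                ≡⟨ cong (_% n) (+-comm (suc (s / n) * n) i) ⟩
      (i + suc (s / n) * n) % n              ≡⟨ [m+kn]%n≡m%n i (suc (s / n)) n ⟩
      i % n                                  ∎
      where
      open ≡-Reasoning
      multiple : (n ∸ s % n) + s ≡ n + s / n * n
      multiple = begin
        (n ∸ s % n) + s                     ≡⟨ cong (λ z → (n ∸ s % n) + z) (m≡m%n+[m/n]*n s n) ⟩
        (n ∸ s % n) + (s % n + s / n * n)   ≡⟨ +-assoc (n ∸ s % n) (s % n) _ ⟨
        (n ∸ s % n) + s % n + s / n * n     ≡⟨ cong (_+ s / n * n) (m∸n+n≡m (<⇒≤ (m%n<n s n))) ⟩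
        n + s / n * n                       ∎

  %-+ʳ : ∀ a b → (a + b % n) % n ≡ (a + b) % n
  %-+ʳ a b = trans (%-distribˡ-+ a (b % n) n)
    (trans (cong (λ z → (a % n + z) % n) (m%n%n≡m%n b n)) (sym (%-distribˡ-+ a b n)))

  pos-V : ∀ s {i} → i < n → pos s (V (s + i)) ≡ i
  pos-V s {i} i<n rewrite toℕ-V (s + i) =
    trans (%-+ʳ (n ∸ s % n) (s + i)) (trans (complement s i) (m<n⇒m%n≡m i<n))

  V-pos : ∀ s v → V (s + pos s v) ≡ v
  V-pos s v = toℕ-injective (begin
    toℕ (V (s + pos s v))              ≡⟨ toℕ-V _ ⟩
    (s + ((n ∸ s % n) + toℕ v) % n) % n ≡⟨ %-+ʳ s _ ⟩
    (s + ((n ∸ s % n) + toℕ v)) % n     ≡⟨ cong (_% n) (+-comm s _) ⟩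
    ((n ∸ s % n) + toℕ v + s) % n       ≡⟨ cong (_% n) (+-assoc (n ∸ s % n) (toℕ v) s) ⟩
    ((n ∸ s % n) + (toℕ v + s)) % n     ≡⟨ cong (λ z → ((n ∸ s % n) + z) % n) (+-comm (toℕ v) s) ⟩
    ((n ∸ s % n) + (s + toℕ v)) % n     ≡⟨ complement s (toℕ v) ⟩
    toℕ v % n                           ≡⟨ m<n⇒m%n≡m (toℕ<n v) ⟩
    toℕ v                               ∎)
    where open ≡-Reasoning

  V-injective : ∀ s {i j} → i < n → j < n → V (s + i) ≡ V (s + j) → i ≡ j
  V-injective s i<n j<n p = trans (sym (pos-V s i<n)) (trans (cong (pos s) p) (pos-V s j<n))

  joins-pos : ∀ s e {i j} → i < n → j < n → Joins e (V (s + i)) (V (s + j)) →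
              (pos s (lo e) ≡ i × pos s (hi e) ≡ j) ⊎ (pos s (lo e) ≡ j × pos s (hi e) ≡ i)
  joins-pos s e i<n j<n (inj₁ (refl , refl)) = inj₁ (pos-V s i<n , pos-V s j<n)
  joins-pos s e i<n j<n (inj₂ (refl , refl)) = inj₂ (pos-V s j<n , pos-V s i<n)

  joins-V-≡ : ∀ s e {x y z w} → x < y → y < n → z < w → w < n →
    Joins e (V (s + x)) (V (s + y)) → Joins e (V (s + z)) (V (s + w)) → x ≡ z × y ≡ w
  joins-V-≡ s e x<y y<n z<w w<n p q with joins-ends e p q
  ... | inj₁ (a , b) =
        V-injective s (<-trans x<y y<n) (<-trans z<w w<n) a , V-injective s y<n w<n b
  ... | inj₂ (a , b) with refl ← V-injective s (<-trans x<y y<n) w<n a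
                        | refl ← V-injective s y<n (<-trans z<w w<n) b =
    contradiction x<y (<-asym z<w)

  -- Rotating the true labels by `n ∸ s % n` turns them into positions counted from `s`. The passage
  -- goes through `Cross`, which does not distinguish the two ends of an edge, because rotation may
  -- exchange `lo` and `hi`.
  crosses⇒interlaced : ∀ s e f {x y z w} → x < y → y < n → z < w → w < n →
    Joins e (V (s + x)) (V (s + y)) → Joins f (V (s + z)) (V (s + w)) →
    Crosses e f → Interlaced x y z w
  crosses⇒interlaced s e f x<y y<n z<w w<n p q c
    with joins-pos s e (<-trans x<y y<n) y<n p | joins-pos s f (<-trans z<w w<n) w<n q
       | cross-rotation (n ∸ s % n) (toℕ<n (lo e)) (toℕ<n (hi e)) (toℕ<n (lo f)) (toℕ<n (hi f)) c
  ... | inj₁ (refl , refl) | inj₁ (refl , refl) | c′ = cross⇒interlaced x<y z<w c′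
  ... | inj₁ (refl , refl) | inj₂ (refl , refl) | c′ = cross⇒interlaced x<y z<w (cross-swapʳ c′)
  ... | inj₂ (refl , refl) | inj₁ (refl , refl) | c′ = cross⇒interlaced x<y z<w (cross-swapˡ c′)
  ... | inj₂ (refl , refl) | inj₂ (refl , refl) | c′ =
    cross⇒interlaced x<y z<w (cross-swapˡ (cross-swapʳ c′))

  interlaced⇒crosses : ∀ s e f {x y z w} → x < n → y < n → z < n → w < n →
    Joins e (V (s + x)) (V (s + y)) → Joins f (V (s + z)) (V (s + w)) →
    Interlaced x y z w → Crosses e f
  interlaced⇒crosses s e f {x} {y} {z} {w} x< y< z< w< p q c =
    cross⇒interlaced {a = toℕ (lo e)} (lo<hi e) (lo<hi f) (orient p q crossing)
    where
    crossing : Cross (toℕ (V (s + x))) (toℕ (V (s + y))) (toℕ (V (s + z))) (toℕ (V (s + w)))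
    crossing rewrite toℕ-V (s + x) | toℕ-V (s + y) | toℕ-V (s + z) | toℕ-V (s + w) =
      cross-rotation s x< y< z< w< c
    orient : ∀ {a b c d} → Joins e a b → Joins f c d → Cross (toℕ a) (toℕ b) (toℕ c) (toℕ d) →
             Cross (toℕ (lo e)) (toℕ (hi e)) (toℕ (lo f)) (toℕ (hi f))
    orient (inj₁ (refl , refl)) (inj₁ (refl , refl)) x = x
    orient (inj₁ (refl , refl)) (inj₂ (refl , refl)) x = cross-swapʳ x
    orient (inj₂ (refl , refl)) (inj₁ (refl , refl)) x = cross-swapˡ x
    orient (inj₂ (refl , refl)) (inj₂ (refl , refl)) x = cross-swapˡ (cross-swapʳ x)

-- Lists without repetition

module _ {A : Set} where

  lookup-injective : ∀ {xs : List A} → Unique xs → ∀ i j → lookup xs i ≡ lookup xs j → i ≡ j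
  lookup-injective (x≢ ∷ u) Fin.zero    Fin.zero    p = refl
  lookup-injective (x≢ ∷ u) Fin.zero    (Fin.suc j) p =
    contradiction p (All.lookup x≢ (∈-lookup j))
  lookup-injective (x≢ ∷ u) (Fin.suc i) Fin.zero    p =
    contradiction (sym p) (All.lookup x≢ (∈-lookup i))
  lookup-injective (x≢ ∷ u) (Fin.suc i) (Fin.suc j) p = cong Fin.suc (lookup-injective u i j p)

  unique⊆⇒length≤ : ∀ {xs ys : List A} → Unique xs → (∀ {x} → x ∈ xs → x ∈ ys) →
    length xs ≤ length ys
  unique⊆⇒length≤ {xs} {ys} u sub = injective⇒≤ {f = f} λ {i} {j} fi≡fj →
    lookup-injective u i j (begin
      lookup xs i     ≡⟨ lookup-index (sub (∈-lookup i)) ⟩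
      lookup ys (f i) ≡⟨ cong (lookup ys) fi≡fj ⟩
      lookup ys (f j) ≡⟨ lookup-index (sub (∈-lookup j)) ⟨
      lookup xs j     ∎)
    where
    open ≡-Reasoning
    f : Fin (length xs) → Fin (length ys)
    f i = index (sub (∈-lookup i))

  -- Otherwise `y` could be put in front of `xs`, giving a repetition-free list inside `ys` that is
  -- longer than `ys`.
  unique⊆⇒⊇ : DecidableEquality A → ∀ {xs ys : List A} → Unique xs → (∀ {x} → x ∈ xs → x ∈ ys) →
    length ys ≤ length xs → ∀ {y} → y ∈ ys → y ∈ xs
  unique⊆⇒⊇ _≟_ {xs} {ys} u sub le {y} y∈ys with DecMembership._∈?_ _≟_ y xs
  ... | yes p = p
  ... | no y∉xs = contradiction
    (unique⊆⇒length≤ {xs = y ∷ xs} (All.¬Any⇒All¬ xs y∉xs ∷ u)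
      (λ { (here refl) → y∈ys ; (there q) → sub q }))
    (<⇒≱ (s≤s le))

-- Plane perfect matchings of labels

module PerfectMatching (n : ℕ) (R : ℕ → ℕ → Set)
  (R-total : ∀ {x} → x < n → ∃ (R x))
  (R-bounded : ∀ {x y} → R x y → y < n)
  (R-sym : ∀ {x y} → R x y → R y x)
  (R-functional : ∀ {x y z} → R x y → R x z → y ≡ z)
  (R-irrefl : ∀ {x} → ¬ R x x)
  (R-planar : ∀ {x y z w} → R x y → R z w → x < z → z < y → ¬ (y < w))
  where

  Closed : ℕ → ℕ → Set
  Closed s l = ∀ {x y} → R x y → s ≤ x → x < s + l → s ≤ y × y < s + l

  -- A partner outside would make a chord crossing that of `x` and `y`, and these two labels are
  -- taken by each other.
  closed-inside : ∀ {x y l} → R x y → y ≡ suc (x + l) → Closed (suc x) l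
  closed-inside {x} {y} {l} xy refl {z} {w} zw x<z z<y with <-cmp w x
  ... | tri< w<x _ _ = ⊥-elim (R-planar (R-sym zw) xy w<x x<z z<y)
  ... | tri≈ _ refl _ = ⊥-elim (<-irrefl (R-functional (R-sym zw) xy) z<y)
  ... | tri> _ _ x<w with <-cmp w y
  ...   | tri< w<y _ _ = x<w , w<y
  ...   | tri≈ _ refl _ = ⊥-elim (<-irrefl (R-functional (R-sym xy) (R-sym zw)) x<z)
  ...   | tri> _ _ y<w = ⊥-elim (R-planar xy zw x<z z<y y<w)

  -- A partner strictly between `s` and `y` would give a crossing, the two ends are taken, and the
  -- rest of the outside is excluded by the larger closed interval.
  closed-after : ∀ {s l l′ y} → R s y → y ≡ s + l → Closed s (l + suc l′) → Closed (suc y) l′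
  closed-after {s} {l} {l′} {y} sy refl c {x} {w} xw y<x x<
    with c xw (linear 3 (λ s l x → s :+ l :< x ∷ [] ⊢ s :≤ x) s l x y<x)
              (linear 4 (λ s l l′ x → x :< # 1 :+ (s :+ l :+ l′) ∷ []
                ⊢ x :< s :+ (l :+ (# 1 :+ l′))) s l l′ x x<)
  ... | s≤w , w< with <-cmp w y
  ...   | tri> _ _ y<w = y<w ,
        linear 4 (λ s l l′ x → x :< s :+ (l :+ (# 1 :+ l′)) ∷ [] ⊢ x :< # 1 :+ (s :+ l :+ l′))
          s l l′ w w<
  ...   | tri≈ _ refl _ = ⊥-elim (<-irrefl (R-functional (R-sym sy) (R-sym xw))
            (linear 3 (λ s l x → s :+ l :< x ∷ [] ⊢ s :< x) s l x y<x))
  ...   | tri< w<y _ _ with m≤n⇒m<n∨m≡n s≤w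
  ...     | inj₁ s<w = ⊥-elim (R-planar sy (R-sym xw) s<w w<y y<x)
  ...     | inj₂ refl = ⊥-elim (<-irrefl (R-functional sy (R-sym xw)) y<x)

  -- The leftmost label of a closed interval and its partner split the rest
  -- of the interval into two closed intervals.
  closed-even : ∀ b l → l ≤ b → ∀ s → s + l ≤ n → Closed s l → ∃[ k ] l ≡ k + k
  closed-even b zero _ s _ c = 0 , refl
  closed-even (suc b) (suc l) (s≤s l≤b) s s+l≤n c
    with R-total {s} (linear 3 (λ s l n → s :+ (# 1 :+ l) :≤ n ∷ [] ⊢ s :< n) s l n s+l≤n)
  ... | y , sy with c sy ≤-refl (linear 2 (λ s l → [] ⊢ s :< s :+ (# 1 :+ l)) s l)
  ...   | s≤y , y< with m≤n⇒m<n∨m≡n s≤y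
  ...     | inj₂ refl = ⊥-elim (R-irrefl sy)
  ...     | inj₁ s<y with m≤n⇒∃[o]m+o≡n s<y
  ...       | l₁ , refl with m≤n⇒∃[o]m+o≡n {suc l₁} {l}
        (linear 3 (λ s l k → # 1 :+ (s :+ k) :< s :+ (# 1 :+ l) ∷ [] ⊢ k :< l) s l l₁ y<)
  ...         | l₂ , refl
    with closed-even b l₁
      (linear 3 (λ l₁ l₂ b → # 1 :+ (l₁ :+ l₂) :≤ b ∷ [] ⊢ l₁ :≤ b) l₁ l₂ b l≤b)
           (suc s) (linear 4 (λ s l₁ l₂ n → s :+ (# 2 :+ (l₁ :+ l₂)) :≤ n ∷ []
             ⊢ # 1 :+ s :+ l₁ :≤ n) s l₁ l₂ n s+l≤n)
           (closed-inside sy refl)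
       | closed-even b l₂
         (linear 3 (λ l₁ l₂ b → # 1 :+ (l₁ :+ l₂) :≤ b ∷ [] ⊢ l₂ :≤ b) l₁ l₂ b l≤b)
           (suc (suc s + l₁))
             (linear 4 (λ s l₁ l₂ n → s :+ (# 2 :+ (l₁ :+ l₂)) :≤ n ∷ []
               ⊢ # 2 :+ (s :+ l₁) :+ l₂ :≤ n) s l₁ l₂ n s+l≤n)
           (closed-after {s} {suc l₁} {l₂} sy (sym (+-suc s l₁))
             (subst (Closed s) (cong suc (sym (+-suc l₁ l₂))) c))
  ...           | i , refl | j , refl =
    suc (i + j) ,
      linear 2 (λ i j → []
        ⊢ # 2 :+ (i :+ i :+ (j :+ j)) :≡ # 1 :+ (i :+ j) :+ (# 1 :+ (i :+ j))) i j

  -- The labels strictly between `x` and `y` form a closed interval, so their number is even.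
  odd-span : ∀ {x y} → R x y → x < y → ∃[ k ] y ≡ suc (x + (k + k))
  odd-span {x} {y} xy x<y with m≤n⇒∃[o]m+o≡n x<y
  ... | l , refl with closed-even l l ≤-refl (suc x) (<⇒≤ (R-bounded xy)) (closed-inside xy refl)
  ...   | k , refl = k , refl

  -- The partner of x is not among x, …, x + 2e + 1.
  Outside : ℕ → ℕ → Set
  Outside x e = ∀ {w} → R x w → x ≤ w → x + suc (e + e) < w

  outside-start : ∀ {x} → ¬ R x (suc x) → Outside x 0
  outside-start {x} ¬r {w} xw x≤w with m≤n⇒m<n∨m≡n x≤w
  ... | inj₂ refl = ⊥-elim (R-irrefl xw)
  ... | inj₁ x<w with m≤n⇒m<n∨m≡n x<w
  ...   | inj₂ refl = ⊥-elim (¬r xw)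
  ...   | inj₁ p = linear 2 (λ x w → # 2 :+ x :≤ w ∷ [] ⊢ x :+ # 1 :< w) x w p

  -- Of the two labels added, x + 2e + 2 has even distance from `x` and cannot be its partner; the
  -- hypothesis excludes x + 2e + 3.
  outside-widen : ∀ {x e} → ¬ R x (x + suc (suc e + suc e)) → Outside x e → Outside x (suc e)
  outside-widen {x} {e} ¬r o {w} xw x≤w with m≤n⇒m<n∨m≡n x≤w
  ... | inj₂ refl = ⊥-elim (R-irrefl xw)
  ... | inj₁ x<w with odd-span xw x<w | o xw x≤w
  ...   | k , refl | o′ with <-cmp k (suc e)
  ...     | tri< k≤e _ _ = ⊥-elim
        (linear 3 (λ x k e → k
          :< # 1 :+ e ∷ x :+ (# 1 :+ (e :+ e)) :< # 1 :+ (x :+ (k :+ k)) ∷ [] ⊢ :⊥) x k e k≤e o′)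
  ...     | tri≈ _ refl _ = ⊥-elim (¬r (subst (R x) (sym (+-suc x _)) xw))
  ...     | tri> _ _ e<k =
        linear 3 (λ x k e → # 1 :+ e :< k ∷ []
          ⊢ x :+ (# 1 :+ (# 1 :+ e :+ (# 1 :+ e))) :< # 1 :+ (x :+ (k :+ k))) x k e e<k

  -- A partner of `x` to the right of x + 1 encloses x + 1 and therefore also the partner of x + 1,
  -- which already lies far to the right.
  outside-shift : ∀ {x e} → suc x < n → ¬ R x (suc x) → Outside (suc x) e → Outside x (suc e)
  outside-shift {x} {e} x+1<n ¬r o {w} xw x≤w with m≤n⇒m<n∨m≡n x≤w
  ... | inj₂ refl = ⊥-elim (R-irrefl xw)
  ... | inj₁ x<w with m≤n⇒m<n∨m≡n x<w
  ...   | inj₂ refl = ⊥-elim (¬r xw)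
  ...   | inj₁ x+1<w with m≤n⇒∃[o]m+o≡n x<w | R-total x+1<n
  ...     | l , refl | w′ , x+1w′
    with closed-inside xw refl x+1w′ ≤-refl x+1<w
  ...       | x<w′ , w′<w =
    linear 4 (λ x e w w′ → # 1 :+ x :+ (# 1 :+ (e :+ e)) :< w′ ∷ w′ :< w ∷ []
      ⊢ x :+ (# 1 :+ (# 1 :+ e :+ (# 1 :+ e))) :< w)
      x e _ w′ (o x+1w′ x<w′) w′<w

-- Vertices covered by a matching

joins? : ∀ {n} (e : Edge n) u v → Dec (Joins e u v)
joins? e u v = ((lo e Fin.≟ u) ×-dec (hi e Fin.≟ v)) ⊎-dec ((lo e Fin.≟ v) ×-dec (hi e Fin.≟ u))

incident-other : ∀ {n} (e : Edge n) {v} → Incident v e → ∃[ u ] Joins e v u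
incident-other e (inj₁ refl) = hi e , inj₁ (refl , refl)
incident-other e (inj₂ refl) = lo e , inj₂ (refl , refl)

ends : ∀ {n} → List (Edge n) → List (Fin n)
ends []       = []
ends (e ∷ es) = lo e ∷ hi e ∷ ends es

length-ends : ∀ {n} (es : List (Edge n)) → length (ends es) ≡ 2 * length es
length-ends []       = refl
length-ends (e ∷ es) = cong suc (trans (cong suc (length-ends es)) (sym (+-suc (length es) _)))

∈-ends : ∀ {n} (es : List (Edge n)) {v} → v ∈ ends es → ∃[ e ] e ∈ es × Incident v e
∈-ends (e ∷ es) (here p)         = e , here refl , inj₁ p
∈-ends (e ∷ es) (there (here p)) = e , here refl , inj₂ p
∈-ends (e ∷ es) (there (there p)) with f , f∈ , i ← ∈-ends es p = f , there f∈ , i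

ends-unique : ∀ {n} (es : List (Edge n)) → Unique es →
  (∀ e f → e ∈ es → f ∈ es → e ≢ f → Disjoint e f) → Unique (ends es)
ends-unique [] [] d = []
ends-unique {n} (e ∷ es) (e≢ ∷ u) d =
  ((λ p → <-irrefl (cong toℕ p) (lo<hi e)) ∷ All.tabulate (λ v∈ p → off v∈ (inj₁ (sym p)))) ∷
  All.tabulate (λ v∈ p → off v∈ (inj₂ (sym p))) ∷
  ends-unique es u (λ f g f∈ g∈ → d f g (there f∈) (there g∈))
  where
  off : ∀ {v} → v ∈ ends es → ¬ Incident v e
  off v∈ i with ∈-ends es v∈
  ... | f , f∈ , j = proj₁ (d e f (here refl) (there f∈) (All.lookup e≢ f∈)) _ (i , j)

-- The 2m ends of `m` disjoint edges are distinct, so they exhaust the 2m vertices.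
spm-covers : ∀ m (es : List (Edge (2 * m))) → length es ≡ m → Unique es →
  (∀ e f → e ∈ es → f ∈ es → e ≢ f → Disjoint e f) → ∀ v → ∃[ e ] e ∈ es × Incident v e
spm-covers m es len u d v = ∈-ends es
  (unique⊆⇒⊇ Fin._≟_ {ys = allFin (2 * m)} (ends-unique es u d) (λ {x} _ → ∈-allFin x)
    (≤-reflexive (trans (length-tabulate {n = 2 * m} (λ i → i))
      (sym (trans (length-ends es) (cong (2 *_) len)))))
    (∈-allFin v))

-- ε shifted by one: the k-th edge of the blocker has index k - 1.
record Profile (m t : ℕ) (δ : ℕ → ℕ) : Set where
  field
    2≤t  : 2 ≤ t
    t≤m  : t ≤ m
    flat : ∀ {c} → c < t → δ c ≡ 0
    -- The next two fields say that the lower end c - δ c of a leg is one of the labels 1, ..., t -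
    -- 1, an inner vertex of the path.
    low  : ∀ {c} → t ≤ c → c < m → δ c < c
    high : ∀ {c} → t ≤ c → c < m → c < t + δ c
    -- The case c = t - 1 is included: it compares the first leg with the last path edge, of radius
    -- 0.
    incr : ∀ {c} → t ≤ suc c → suc c < m → δ c < δ (suc c)

  δ≤ : ∀ {c} → c < m → δ c ≤ c
  δ≤ {c} c<m with c <? t
  ... | yes c<t rewrite flat c<t = z≤n
  ... | no c≮t = <⇒≤ (low (≮⇒≥ c≮t) c<m)

  -- The ends of the edge with centre `c` and radius `δ c`; path edges are those of radius 0.
  left right : ℕ → ℕ
  left c  = c ∸ δ c
  right c = suc (c + δ c)

  left+δ : ∀ {c} → c < m → left c + δ c ≡ c
  left+δ c<m = m∸n+n≡m (δ≤ c<m)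

  left<right : ∀ {c} → c < m → left c < right c
  left<right {c} c<m = s≤s (≤-trans (m∸n≤m c (δ c)) (m≤m+n c (δ c)))

-- Profiles give blocking sets

module Polygon (m : ℕ) .{{_ : NonZero m}} where

  instance
    2m≢0 : NonZero (2 * m)
    2m≢0 = m*n≢0 2 m

  n : ℕ
  n = 2 * m

  n≡ : n ≡ m + m
  n≡ = cong (λ z → m + z) (+-identityʳ m)

  open Rotation (2 * m) public

  module _ {t : ℕ} {δ : ℕ → ℕ} (pf : Profile m t δ) (s : ℕ) where
    open Profile pf

    right<n : ∀ {c} → c < m → right c < n
    right<n {c} c<m =
      linear 4 (λ c d m n → d :≤ c ∷ c :< m ∷ n :≡ m :+ m ∷ [] ⊢ # 1 :+ (c :+ d) :< n)
      c (δ c) m n (δ≤ c<m) c<m n≡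

    left<n : ∀ {c} → c < m → left c < n
    left<n c<m = <-trans (left<right c<m) (right<n c<m)

    OnProfile : ℕ → Pred (Edge n) 0ℓ
    OnProfile c e = Joins e (V (s + left c)) (V (s + right c))

    Profiled : Pred (Edge n) 0ℓ
    Profiled e = ∃[ c ] c < m × OnProfile c e

    profiled? : ∀ e → Dec (Profiled e)
    profiled? e = anyUpTo? (λ c → joins? e _ _) m

    -- In labels counted from `s`, a matching without profiled edges becomes a plane perfect
    -- matching `R` avoiding every chord from `left c` to `right c`. Growing one chord up to the
    -- whole circle then leaves no partner for the label 0.
    profiled-blocking : IsBlocking m Profiled
    profiled-blocking M ((es , len , u , M⊆ , ⊆M) , d) with any? profiled? es
    ... | yes p = let e , e∈ , pe = find p in e , pe , ⊆M e∈
    ... | no ¬p = ⊥-elim absurd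
      where
      dj : ∀ e f → e ∈ es → f ∈ es → e ≢ f → Disjoint e f
      dj e f e∈ f∈ = d e f (⊆M e∈) (⊆M f∈)

      R : ℕ → ℕ → Set
      R x y = ∃[ e ] e ∈ es × Joins e (V (s + x)) (V (s + y)) × x < n × y < n

      R-total : ∀ {x} → x < n → ∃ (R x)
      R-total {x} x<n with spm-covers m es len u dj (V (s + x))
      ... | e , e∈ , i with incident-other e i
      ... | v , j =
            pos s v , e , e∈ , subst (Joins e (V (s + x))) (sym (V-pos s v)) j , x<n , pos<n s v

      R-functional : ∀ {x y z} → R x y → R x z → y ≡ z
      R-functional {x} (e , e∈ , p , x< , y<) (f , f∈ , q , _ , z<) with e ≟ₑ f
      ... | no e≢f =
            contradiction (joins-incident e p , joins-incident f q) (proj₁ (dj e f e∈ f∈ e≢f) _)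
      ... | yes refl with joins-ends e p q
      ...   | inj₁ (_ , y≡z) = V-injective s y< z< y≡z
      ...   | inj₂ (x≡z , y≡x) = V-injective s y< z< (trans y≡x x≡z)

      R-planar : ∀ {x y z w} → R x y → R z w → x < z → z < y → ¬ (y < w)
      R-planar (e , e∈ , p , x< , y<) (f , f∈ , q , z< , w<) x<z z<y y<w with e ≟ₑ f
      ... | no e≢f = proj₂ (dj e f e∈ f∈ e≢f)
              (interlaced⇒crosses s e f x< y< z< w< p q (inj₁ (x<z , z<y , y<w)))
      ... | yes refl =
            <-irrefl (proj₁ (joins-V-≡ s e (<-trans x<z z<y) y< (<-trans z<y y<w) w< p q)) x<z

      open PerfectMatching n R R-total (λ (_ , _ , _ , _ , y<) → y<)
        (λ (e , e∈ , p , x< , y<) → e , e∈ , joins-sym e p , y< , x<)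
        R-functional (λ (e , _ , p , _) → joins-≢ e p refl) R-planar

      ¬R : ∀ {c x y} → c < m → x ≡ left c → y ≡ right c → ¬ R x y
      ¬R {c} c<m refl refl (e , e∈ , p , _) = ¬p (lose e∈ (c , c<m , p))

      ¬R-flat : ∀ {x} → x < t → ¬ R x (suc x)
      ¬R-flat {x} x<t = ¬R (≤-trans x<t t≤m)
        (cong (x ∸_) (sym (flat x<t)))
          (cong suc (trans (sym (+-identityʳ x)) (cong (λ z → x + z) (sym (flat x<t)))))

      below : ∀ {c} → c < m → c < t + δ c
      below {c} c<m with c <? t
      ... | yes c<t = ≤-trans c<t (m≤m+n t (δ c))
      ... | no c≮t = high (≮⇒≥ c≮t) c<m

      -- Shifting keeps the direction of the chord and uses an edge of the
      -- path; widening at a fixed end point uses a leg.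
      outside : ∀ e {x} → t ≤ suc (x + e) → x + e < m → δ (x + e) ≤ e → Outside x e
      outside zero {x} t≤ c<m δ≤0 = outside-start (¬R-flat
        (linear 3 (λ x t d → x :+ # 0 :< t :+ d ∷ d :≤ # 0 ∷ [] ⊢ x :< t) x t _ (below c<m) δ≤0))
      -- The invariant says that the profiled edge with the centre x + e + 1 of the current chord is
      -- no longer than this chord. If it is shorter, the chord is reduced at both ends.
      outside (suc e) {x} t≤ c<m δ≤e with m≤n⇒m<n∨m≡n δ≤e
      ... | inj₁ (s≤s δ≤) =
            outside-shift (≤-trans 1+x<t (≤-trans t≤m (m≤m+n m _))) (¬R-flat (<⇒≤ 1+x<t))
              (outside e (subst (λ c → t ≤ suc c) (+-suc x e) t≤) (subst (_< m) (+-suc x e) c<m)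
                (subst (λ c → δ c ≤ e) (+-suc x e) δ≤))
        where
        1+x<t : suc x < t
        1+x<t = linear 4 (λ x e t d → x :+ (# 1 :+ e) :< t :+ d ∷ d :≤ e ∷ [] ⊢ # 1 :+ x :< t)
          x e t _ (below c<m) δ≤
      -- Here the chord from `x` to x + 2e + 3 is itself the profiled edge. Dropping its last two
      -- labels lowers the centre by one, and `incr` restores the invariant there.
      ... | inj₂ δ≡ =
            outside-widen (¬R c<m left≡ right≡) (outside e t≤′ (<⇒≤ c<m′) (δ′ (δ-suc t≤′ c<m′)))
        where
        c<m′ : suc (x + e) < m
        c<m′ = subst (_< m) (+-suc x e) c<m
        left≡ : x ≡ left (x + suc e)
        left≡ = sym (trans (cong (x + suc e ∸_) δ≡) (m+n∸n≡m x (suc e)))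
        right≡ : x + suc (suc e + suc e) ≡ right (x + suc e)
        right≡ = trans
          (linear 2 (λ x e → []
            ⊢ x :+ (# 1 :+ (# 1 :+ e :+ (# 1 :+ e))) :≡ # 1 :+ (x :+ (# 1 :+ e) :+ (# 1 :+ e)))
            x e)
          (cong (λ d → suc (x + suc e + d)) (sym δ≡))
        t≤′ : t ≤ suc (x + e)
        t≤′ with x + suc e <? t
        ... | yes c<t = contradiction (trans (sym δ≡) (flat c<t)) λ ()
        ... | no c≮t = subst (t ≤_) (+-suc x e) (≮⇒≥ c≮t)
        δ-suc : t ≤ suc (x + e) → suc (x + e) < m → δ (x + e) < δ (x + suc e)
        δ-suc p q = subst (λ c → δ (x + e) < δ c) (sym (+-suc x e)) (incr p q)
        δ′ : δ (x + e) < δ (x + suc e) → δ (x + e) ≤ e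
        δ′ p = ≤-pred (subst (suc (δ (x + e)) ≤_) δ≡ p)

      absurd : ⊥
      absurd with m≤n⇒∃[o]m+o≡n (≤-trans (<⇒≤ 2≤t) t≤m)
      -- With m = k + 1 the chord from 0 to 2m - 1 has centre and radius `k`, and `δ≤` gives the
      -- invariant for it; no label remains beyond 2m - 1.
      ... | k , refl with R-total {0} (s≤s z≤n)
      ...   | w , 0w@(_ , _ , _ , _ , w<n) =
        linear 2 (λ k w → # 1 :+ (k :+ k) :< w ∷ w :< # 1 :+ (k :+ (# 1 :+ k :+ # 0)) ∷ [] ⊢ :⊥)
          k w
          (outside k t≤m ≤-refl (δ≤ ≤-refl) 0w z≤n) w<n

-- Caterpillars

-- A walk that never turns back and steps up once goes up forever, so on a
-- cycle both neighbours of the starting point are its parent.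
module Forest {A : Set} (_~_ : A → A → Set) (rank : A → ℕ)
  (~-sym : ∀ {u v} → u ~ v → v ~ u)
  (~-ranked : ∀ {u v} → u ~ v → rank u < rank v ⊎ rank v < rank u)
  (parent-unique : ∀ {u v w} → u ~ v → w ~ v → rank u < rank v → rank w < rank v → u ≡ w)
  where

  NoTurn : List A → Set
  NoTurn (x ∷ y ∷ z ∷ l) = x ≢ z × NoTurn (y ∷ z ∷ l)
  NoTurn _               = ⊤

  rises : ∀ {x y l} → Linked _~_ (x ∷ y ∷ l) → NoTurn (x ∷ y ∷ l) → rank x < rank y →
          ∀ {w} → w ∈ y ∷ l → rank x < rank w
  rises _ _ x<y (here refl) = x<y
  rises {l = z ∷ l} (xy ∷ yz ∷ k) (x≢z , t) x<y (there w∈) with ~-ranked yz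
  ... | inj₁ y<z = <-trans x<y (rises (yz ∷ k) t y<z w∈)
  ... | inj₂ z<y = contradiction (parent-unique xy (~-sym yz) x<y z<y) x≢z

  final : A → List A → A
  final x []       = x
  final x (y ∷ ys) = final y ys

  final∈ : ∀ x ys → final x ys ∈ x ∷ ys
  final∈ x []       = here refl
  final∈ x (y ∷ ys) = there (final∈ y ys)

  -- After a step up the walk keeps rising, so a walk whose last step goes down has gone down all
  -- the way.
  falls : ∀ x ys z → Linked _~_ (x ∷ ys ∷ʳ z) → NoTurn (x ∷ ys ∷ʳ z) →
    (final x ys ~ z × rank (final x ys) < rank z) ⊎ rank z < rank x
  falls x [] z (xz ∷ _) _ with ~-ranked xz
  ... | inj₁ x<z = inj₁ (xz , x<z)
  ... | inj₂ z<x = inj₂ z<x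
  falls x (y ∷ ys) z k@(xy ∷ k′) t with falls y ys z k′ (tail y ys t)
    where
    tail : ∀ y ys → NoTurn (x ∷ y ∷ ys ∷ʳ z) → NoTurn (y ∷ ys ∷ʳ z)
    tail y []       t = proj₂ t
    tail y (_ ∷ _)  t = proj₂ t
  ... | inj₁ p = inj₁ p
  ... | inj₂ z<y with ~-ranked xy
  ...   | inj₂ y<x = inj₂ (<-trans z<y y<x)
  ...   | inj₁ x<y with <-cmp (rank z) (rank x)
  ...     | tri< z<x _ _ = inj₂ z<x
  ...     | _ = ⊥-elim (up-down ys k t z<y x<y)
    where
    up-down : ∀ ys → Linked _~_ (x ∷ y ∷ ys ∷ʳ z) → NoTurn (x ∷ y ∷ ys ∷ʳ z) →
              rank z < rank y → rank x < rank y → ⊥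
    up-down [] (xy ∷ yz ∷ _) (x≢z , _) z<y x<y = x≢z (parent-unique xy (~-sym yz) x<y z<y)
    up-down (w ∷ ws) (xy ∷ yw ∷ k) (x≢w , t) z<y x<y with ~-ranked yw
    ... | inj₁ y<w = <-asym z<y (rises (yw ∷ k) t y<w (∈-++⁺ʳ (w ∷ ws) (here refl)))
    ... | inj₂ w<y = x≢w (parent-unique xy (~-sym yw) x<y w<y)

  noTurn : ∀ x ys z → Unique (x ∷ ys) → All (z ≢_) (x ∷ ys) → NoTurn (x ∷ ys ∷ʳ z)
  noTurn x []            z u a = tt
  noTurn x (y ∷ [])      z u (z≢x ∷ a) = ≢-sym z≢x , tt
  noTurn x (y ∷ y′ ∷ ys) z ((_ ∷ x≢y′ ∷ _) ∷ u) (_ ∷ a) = x≢y′ , noTurn y (y′ ∷ ys) z u a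

  acyclic : ∀ v vs → 2 ≤ length vs → Unique (v ∷ vs) → ¬ Linked _~_ (v ∷ vs ∷ʳ v)
  acyclic v (y ∷ []) (s≤s ())
  acyclic v (y ∷ y′ ∷ ys) _ (v≢@(_ ∷ v≢y′ ∷ _) ∷ u@(y≢ ∷ _)) k@(vy ∷ k′) with ~-ranked vy
  ... | inj₁ v<y = <-irrefl refl (rises k (v≢y′ , t) v<y (∈-++⁺ʳ (y ∷ y′ ∷ ys) (here refl)))
    where t = noTurn y (y′ ∷ ys) v u v≢
  ... | inj₂ y<v with falls v (y ∷ y′ ∷ ys) v k (v≢y′ , noTurn y (y′ ∷ ys) v u v≢)
  ...   | inj₁ (p , q) = All.lookup y≢ (final∈ y′ ys) (parent-unique (~-sym vy) p y<v q)
  ...   | inj₂ v<v = <-irrefl refl v<v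

-- Inner vertices of paths and consecutive entries of lists

inner : ∀ {A : Set} → List A → List A
inner (x ∷ y ∷ z ∷ l) = y ∷ inner (y ∷ z ∷ l)
inner _               = []

length-inner : ∀ {A : Set} (l : List A) → length l ≤ suc (suc (length (inner l)))
length-inner []              = z≤n
length-inner (x ∷ [])        = s≤s z≤n
length-inner (x ∷ y ∷ [])    = s≤s (s≤s z≤n)
length-inner (x ∷ y ∷ z ∷ l) = s≤s (length-inner (y ∷ z ∷ l))

all-inner : ∀ {A : Set} {P : A → Set} {x} l → All P l → All P (inner (x ∷ l))
all-inner []          _        = []
all-inner (y ∷ [])    _        = []
all-inner (y ∷ z ∷ l) (p ∷ ps) = p ∷ all-inner (z ∷ l) ps

unique-inner : ∀ {A : Set} (l : List A) → Unique l → Unique (inner l)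
unique-inner []              _       = []
unique-inner (x ∷ [])        _       = []
unique-inner (x ∷ y ∷ [])    _       = []
unique-inner (x ∷ y ∷ z ∷ l) (_ ∷ u@(y≢ ∷ _)) =
  all-inner (z ∷ l) y≢ ∷ unique-inner (y ∷ z ∷ l) u

applyUpTo-split : ∀ {A : Set} (f : ℕ → A) k {i} → suc i < k →
  ∃₂ λ us ws → applyUpTo f k ≡ us ++ f i ∷ f (suc i) ∷ ws
applyUpTo-split f (suc (suc k)) {zero} _ = [] , _ , refl
applyUpTo-split f (suc k) {suc i} (s≤s p) with applyUpTo-split (λ j → f (suc j)) k p
... | us , ws , eq = f 0 ∷ us , ws , cong (f 0 ∷_) eq

applyUpTo-split⁻ : ∀ {A : Set} (f : ℕ → A) k us {u w ws} → applyUpTo f k ≡ us ++ u ∷ w ∷ ws →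
  ∃[ i ] suc i < k × u ≡ f i × w ≡ f (suc i)
applyUpTo-split⁻ f (suc (suc k)) [] refl = 0 , s≤s (s≤s z≤n) , refl , refl
applyUpTo-split⁻ f (suc k) (x ∷ us) eq
  with applyUpTo-split⁻ (λ j → f (suc j)) k us (proj₂ (∷-injective eq))
... | i , p , q , r = suc i , s≤s p , q , r

-- If `y` were a leaf, the edges to `x` and to `z` would coincide, and so would their other ends.
non-leaf : ∀ {n} {G : Graph n} {x y z} → x ≢ z → Adj G x y → Adj G y z → ¬ IsLeaf G y
non-leaf {y = y} x≢z (e , e∈ , p) (f , f∈ , q) (_ , e₀ , _ , e₀!)
  with trans (sym (e₀! (e∈ , joins-incident e (joins-sym e p)))) (e₀! (f∈ , joins-incident f q))
... | refl with joins-ends e p q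
...   | inj₁ (x≡y , _) = joins-≢ e p x≡y
...   | inj₂ (x≡z , _) = x≢z x≡z

adj-sym : ∀ {n} {G : Graph n} {x y} → Adj G x y → Adj G y x
adj-sym (e , e∈ , p) = e , e∈ , joins-sym e p

inner-non-leaf : ∀ {n} {G : Graph n} l → Unique l → Linked (Adj G) l →
  All (λ v → ¬ IsLeaf G v) (inner l)
inner-non-leaf []              _ _ = []
inner-non-leaf (x ∷ [])        _ _ = []
inner-non-leaf (x ∷ y ∷ [])    _ _ = []
inner-non-leaf {G = G} (x ∷ y ∷ z ∷ l) ((_ ∷ x≢z ∷ _) ∷ u) (xy ∷ k@(yz ∷ _)) =
  non-leaf {G = G} x≢z xy yz ∷ inner-non-leaf {G = G} (y ∷ z ∷ l) u k

-- Ends of the edges of a profile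

module ProfileBounds {m t : ℕ} {δ : ℕ → ℕ} (pf : Profile m t δ) where
  open Profile pf public

  0<t : 0 < t
  0<t = <⇒≤ 2≤t

  left<t : ∀ {c} → c < m → left c < t
  left<t {c} c<m with c <? t
  ... | yes c<t = ≤-<-trans (m∸n≤m c (δ c)) c<t
  ... | no c≮t = linear 4 (λ c d t l → l :+ d :≡ c ∷ c :< t :+ d ∷ [] ⊢ l :< t) c (δ c) t (left c)
                   (left+δ c<m) (high (≮⇒≥ c≮t) c<m)

  0<left : ∀ {c} → t ≤ c → c < m → 0 < left c
  0<left t≤c c<m = m<n⇒0<n∸m (low t≤c c<m)

  left-flat : ∀ {c} → c < t → left c ≡ c
  left-flat {c} c<t = cong (c ∸_) (flat c<t)

  right-flat : ∀ {c} → c < t → right c ≡ suc c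
  right-flat {c} c<t = cong suc (trans (cong (λ z → c + z) (flat c<t)) (+-identityʳ c))

  δ-grows : ∀ i {c} → t ≤ suc c → c + i < m → δ c + i ≤ δ (c + i)
  δ-grows zero {c} _ _ rewrite +-identityʳ c = ≤-reflexive (+-identityʳ (δ c))
  δ-grows (suc i) {c} t≤ c< rewrite +-suc c i | +-suc (δ c) i =
    ≤-<-trans (δ-grows i t≤ (<⇒≤ c<)) (incr (≤-trans t≤ (s≤s (m≤m+n c i))) c<)

  -- From the last path edge on, the radius grows at least as fast as the centre, so the lower end
  -- never moves forward.
  left-anti : ∀ {c d} → t ≤ suc c → c < d → d < m → left d ≤ left c
  left-anti {c} {d} t≤ c<d d<m with m≤n⇒∃[o]m+o≡n (<⇒≤ c<d)
  ... | i , refl =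
        linear 6 (λ c i l l′ e e′ → l :+ e :≡ c ∷ l′ :+ e′ :≡ c :+ i ∷ e :+ i :≤ e′ ∷ []
          ⊢ l′ :≤ l)
    c i (left c) (left (c + i)) (δ c) (δ (c + i))
    (left+δ (<-trans c<d d<m)) (left+δ d<m) (δ-grows i t≤ d<m)

  δ-mono : ∀ {c d} → c < d → d < m → δ c ≤ δ d
  δ-mono {c} {d} c<d d<m with c <? t
  ... | yes c<t rewrite flat c<t = z≤n
  ... | no c≮t with m≤n⇒∃[o]m+o≡n (<⇒≤ c<d)
  ...   | i , refl = ≤-trans (m≤m+n (δ c) i) (δ-grows i (m≤n⇒m≤1+n (≮⇒≥ c≮t)) d<m)

  right-mono : ∀ {c d} → c < d → d < m → right c < right d
  right-mono c<d d<m = s≤s (+-mono-<-≤ c<d (δ-mono c<d d<m))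

  right-injective : ∀ {c d} → c < m → d < m → right c ≡ right d → c ≡ d
  right-injective {c} {d} c<m d<m eq with <-cmp c d
  ... | tri< c<d _ _ = contradiction eq (<⇒≢ (right-mono c<d d<m))
  ... | tri≈ _ p _ = p
  ... | tri> _ _ d<c = contradiction (sym eq) (<⇒≢ (right-mono d<c c<m))

  left≡0 : ∀ {c} → c < m → left c ≡ 0 → c ≡ 0
  left≡0 {c} c<m eq with c <? t
  ... | yes c<t = trans (sym (left-flat c<t)) eq
  ... | no c≮t = contradiction (sym eq) (<⇒≢ (0<left (≮⇒≥ c≮t) c<m))

  -- Upper ends increase, which leaves one pattern of alternation. A path edge before the last has
  -- no label strictly between its ends, and from the last path edge on the lower ends do not
  -- increase.
  not-interlaced : ∀ {c d} → c < d → d < m →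
    ¬ Interlaced (left c) (right c) (left d) (right d)
  not-interlaced {c} c<d d<m (inj₂ (_ , _ , r)) = <-asym r (right-mono c<d d<m)
  not-interlaced {c} {d} c<d d<m (inj₁ (p , q , _)) with suc c <? t
  ... | yes 1+c<t rewrite left-flat (<⇒≤ 1+c<t) | right-flat (<⇒≤ 1+c<t) =
        <-irrefl refl (≤-trans q p)
  ... | no c≮t = <-irrefl refl (<-≤-trans p (left-anti (≮⇒≥ c≮t) c<d d<m))

module Caterpillar (m : ℕ) .{{_ : NonZero m}} {t : ℕ} {δ : ℕ → ℕ} (pf : Profile m t δ) (s : ℕ)
  where
  open ProfileBounds pf
  open Polygon m

  private
    On : ℕ → Edge n → Set
    On = OnProfile pf s

    W : ℕ → Fin n
    W i = V (s + i)

    R< : ∀ {c} → c < m → right c < n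
    R< = right<n pf s

    L< : ∀ {c} → c < m → left c < n
    L< = left<n pf s

    W-injective : ∀ {i j} → i < n → j < n → W i ≡ W j → i ≡ j
    W-injective = V-injective s

  on-injective : ∀ e {c d} → c < m → d < m → On c e → On d e → c ≡ d
  on-injective e c<m d<m p q = right-injective c<m d<m
    (proj₂ (joins-V-≡ s e (left<right c<m) (R< c<m) (left<right d<m) (R< d<m) p q))

  on : ∀ {c} → c < m → ∃[ e ] On c e
  on c<m = join (λ p → <⇒≢ (left<right c<m) (W-injective (L< c<m) (R< c<m) p))

  -- An arbitrary initial segment is counted because both k = m, the whole set, and k = t, its
  -- boundary edges, are wanted.
  initial-size : ∀ {k} → k ≤ m → HasSize (λ e → ∃[ c ] c < k × On c e) k
  initial-size {k} k≤m = tabulate f , length-tabulate f ,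
    Unique.tabulate⁺ (λ {i} {j} fi≡fj → toℕ-injective (on-injective (f i) (i< i) (i< j) (fOn i)
      (subst (On (toℕ j)) (sym fi≡fj) (fOn j)))) ,
    (λ {e} (c , c<k , p) → subst (_∈ tabulate f)
      (joins-unique (f (fromℕ< c<k)) e (fOn (fromℕ< c<k))
        (subst (λ c → On c e) (sym (toℕ-fromℕ< c<k)) p))
      (∈-tabulate⁺ (fromℕ< c<k))) ,
    λ {e} e∈ → let i , eq = ∈-tabulate⁻ e∈ in toℕ i , toℕ<n i , subst (On (toℕ i)) (sym eq) (fOn i)
    where
    i< : ∀ (i : Fin k) → toℕ i < m
    i< i = <-≤-trans (toℕ<n i) k≤m
    f : Fin k → Edge n
    f i = proj₁ (on (i< i))
    fOn : ∀ i → On (toℕ i) (f i)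
    fOn i = proj₂ (on (i< i))

  profiled-size : HasSize (Profiled pf s) m
  profiled-size = initial-size ≤-refl

  module _ {B : Pred (Edge n) 0ℓ} (B≐ : B ≐ Profiled pf s) where

    private
      G : Graph n
      G = ⟦ B ⟧

      onB : ∀ {c} (c<m : c < m) → B (proj₁ (on c<m))
      onB c<m = proj₂ B≐ (_ , c<m , proj₂ (on c<m))

      infix 4 _~_
      _~_ : Fin n → Fin n → Set
      _~_ = Adj G

    crossing-free : CrossingFree B
    crossing-free e f e∈ f∈ x with proj₁ B≐ e∈ | proj₁ B≐ f∈
    ... | c , c<m , p | d , d<m , q with <-cmp c d
      | crosses⇒interlaced s e f (left<right c<m) (R< c<m) (left<right d<m) (R< d<m) p q x
    ...   | tri< c<d _ _ | i = not-interlaced c<d d<m i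
    ...   | tri> _ _ d<c | i = not-interlaced d<c c<m (swap i)
    ...   | tri≈ _ refl _ | inj₁ (i , _) = <-irrefl refl i
    ...   | tri≈ _ refl _ | inj₂ (i , _) = <-irrefl refl i

    Links : Fin n → Fin n → Set
    Links u v = ∃[ c ] c < m × u ≡ W (left c) × v ≡ W (right c)

    links⇒~ : ∀ {u v} → Links u v → u ~ v
    links⇒~ (c , c<m , refl , refl) = _ , onB c<m , proj₂ (on c<m)

    ~⇒links : ∀ {u v} → u ~ v → Links u v ⊎ Links v u
    ~⇒links (e , e∈ , p) with proj₁ B≐ e∈
    ... | c , c<m , q with joins-ends e p q
    ...   | inj₁ (a , b) = inj₁ (c , c<m , a , b)
    ...   | inj₂ (a , b) = inj₂ (c , c<m , b , a)

    links-ranked : ∀ {u v} → Links u v → pos s u < pos s v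
    links-ranked (c , c<m , refl , refl)
      rewrite pos-V s (L< c<m) | pos-V s (R< c<m) = left<right c<m

    -- Upper ends of different edges differ, so a vertex is the upper end of at most one edge. This
    -- is the uniqueness of parents needed for acyclicity.
    links-unique : ∀ {u v w} → Links u v → Links w v → u ≡ w
    links-unique (c , c<m , refl , p) (d , d<m , refl , q)
      with refl ← right-injective c<m d<m (W-injective (R< c<m) (R< d<m) (trans (sym p) q)) = refl

    ~-ranked : ∀ {u v} → u ~ v → pos s u < pos s v ⊎ pos s v < pos s u
    ~-ranked a with ~⇒links a
    ... | inj₁ l = inj₁ (links-ranked l)
    ... | inj₂ l = inj₂ (links-ranked l)

    ~-links : ∀ {u v} → u ~ v → pos s u < pos s v → Links u v
    ~-links a u<v with ~⇒links a
    ... | inj₁ l = l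
    ... | inj₂ l = contradiction u<v (<-asym (links-ranked l))

    acyclic : IsAcyclic G
    acyclic = Forest.acyclic _~_ (pos s) (adj-sym {G = G}) ~-ranked
      (λ p q u<v w<v → links-unique (~-links p u<v) (~-links q w<v))

    path-edge : ∀ {i} → i < t → W i ~ W (suc i)
    path-edge {i} i<t = links⇒~ (i , <-≤-trans i<t t≤m ,
      cong W (sym (left-flat i<t)) , cong W (sym (right-flat i<t)))

    path-to-start : ∀ {i} → i ≤ t → Star _~_ (W i) (W 0)
    path-to-start {zero}  _ = Star.ε
    path-to-start {suc i} p = adj-sym {G = G} (path-edge p) ◅ path-to-start (<⇒≤ p)

    vertex-cases : ∀ {v} → v U.∈ verts G → (∃[ i ] i < t × v ≡ W i) ⊎
      (∃[ c ] c < m × v ≡ W (right c))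
    vertex-cases (e , e∈ , i) with proj₁ B≐ e∈
    ... | c , c<m , p with incident-joins e p i
    ...   | inj₁ q = inj₁ (left c , left<t c<m , q)
    ...   | inj₂ q = inj₂ (c , c<m , q)

    to-start : ∀ {v} → v U.∈ verts G → Star _~_ v (W 0)
    to-start v∈ with vertex-cases v∈
    ... | inj₁ (i , i<t , refl) = path-to-start (<⇒≤ i<t)
    ... | inj₂ (c , c<m , refl) =
      adj-sym {G = G} (links⇒~ (c , c<m , refl , refl)) ◅ path-to-start (<⇒≤ (left<t c<m))

    ~⇒vertˡ : ∀ {u v} → u ~ v → u U.∈ verts G
    ~⇒vertˡ (e , e∈ , p) = e , e∈ , joins-incident e p

    ~⇒vertʳ : ∀ {u v} → u ~ v → v U.∈ verts G
    ~⇒vertʳ a = ~⇒vertˡ (adj-sym {G = G} a)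

    tree : IsTree G
    tree = (W 0 , ~⇒vertˡ (path-edge 0<t)) ,
      (λ u v u∈ v∈ → to-start u∈ ◅◅ Star.reverse (adj-sym {G = G}) (to-start v∈)) , acyclic

    t<n : t < n
    t<n = linear 3 (λ t m n → t :≤ m ∷ # 2 :≤ t ∷ n :≡ m :+ m ∷ [] ⊢ t :< n) t m n t≤m 2≤t n≡

    W≢ : ∀ {i j} → i < j → j ≤ t → W i ≢ W j
    W≢ i<j j≤t eq = <⇒≢ i<j (W-injective (<-trans i<j (≤-<-trans j≤t t<n)) (≤-<-trans j≤t t<n) eq)

    interior : List (Fin n)
    interior = applyUpTo (λ i → W (suc i)) (pred t)

    suc-pred-t : suc (pred t) ≡ t
    suc-pred-t = suc-pred t {{>-nonZero 0<t}}

    <pred⇒ : ∀ {i} → i < pred t → suc i < t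
    <pred⇒ p = subst (_ <_) suc-pred-t (s≤s p)

    ⇒<pred : ∀ {i} → suc i < t → i < pred t
    ⇒<pred p = ≤-pred (subst (_ <_) (sym suc-pred-t) p)

    interior-non-leaf : ∀ {i} → suc i < t → ¬ IsLeaf G (W (suc i))
    interior-non-leaf {i} p =
      non-leaf {G = G} (W≢ (<-trans (n<1+n i) (n<1+n _)) p) (path-edge (<⇒≤ p)) (path-edge p)

    leaf-at : ∀ {v c} → c < m → (∀ {d} → d < m → v ≡ W (left d) ⊎ v ≡ W (right d) → c ≡ d) →
      v ≡ W (left c) ⊎ v ≡ W (right c) → IsLeaf G v
    leaf-at {v} {c} c<m only v≡ =
      (e , onB c<m , inc) , e , (onB c<m , inc) , λ {f} (f∈ , i) → same f f∈ i
      where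
      e = proj₁ (on c<m)
      inc : Incident v e
      inc = [ (λ p → subst (λ v → Incident v e) (sym p) (joins-incident e (proj₂ (on c<m)))) ,
              (λ p → subst (λ v → Incident v e) (sym p)
                (joins-incident e (joins-sym e (proj₂ (on c<m))))) ]′ v≡
      same : ∀ f → B f → Incident v f → e ≡ f
      same f f∈ i with proj₁ B≐ f∈
      ... | d , d<m , p with refl ← only d<m (incident-joins f p i) =
            joins-unique e f (proj₂ (on c<m)) p

    start-leaf : IsLeaf G (W 0)
    start-leaf = leaf-at (<-≤-trans 0<t t≤m) only (inj₁ (cong W (sym (left-flat 0<t))))
      where
      only : ∀ {d} → d < m → W 0 ≡ W (left d) ⊎ W 0 ≡ W (right d) → 0 ≡ d
      only d<m (inj₁ p) = sym (left≡0 d<m (sym (W-injective (≤-<-trans z≤n (L< d<m)) (L< d<m) p)))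
      only d<m (inj₂ p) = contradiction (W-injective (≤-<-trans z≤n (L< d<m)) (R< d<m) p) λ ()

    -- Lower ends are all below `t`, and no other edge has the same upper end.
    far-leaf : ∀ {c} → c < m → t ≤ right c → IsLeaf G (W (right c))
    far-leaf {c} c<m t≤ = leaf-at c<m only (inj₂ refl)
      where
      only : ∀ {d} → d < m → W (right c) ≡ W (left d) ⊎ W (right c) ≡ W (right d) → c ≡ d
      only d<m (inj₁ p) = contradiction (W-injective (R< c<m) (L< d<m) p)
        (≢-sym (<⇒≢ (<-≤-trans (left<t d<m) t≤)))
      only d<m (inj₂ p) = right-injective c<m d<m (W-injective (R< c<m) (R< d<m) p)

    non-leaf⇒interior : ∀ {v} → v U.∈ verts G → ¬ IsLeaf G v → v ∈ interior
    non-leaf⇒interior v∈ ¬l with vertex-cases v∈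
    ... | inj₁ (zero , _ , refl) = contradiction start-leaf ¬l
    ... | inj₁ (suc i , i<t , refl) = ∈-applyUpTo⁺ _ (⇒<pred i<t)
    ... | inj₂ (c , c<m , refl) with right c <? t
    ...   | yes r<t = ∈-applyUpTo⁺ (λ i → W (suc i)) (⇒<pred r<t)
    ...   | no r≮t = contradiction (far-leaf c<m (≮⇒≥ r≮t)) ¬l

    pruned-path : IsPathOrEmptyGraph (pruneLeaves G)
    pruned-path = interior ,
      Unique.applyUpTo⁺₁ _ _ (λ i<j j< → W≢ (s≤s i<j) (<⇒≤ (<pred⇒ j<))) ,
      ((λ (v∈ , ¬l) → non-leaf⇒interior v∈ ¬l) , verts⊇) ,
      (λ {e} (e∈ , ¬l) → edges⊆ e e∈ ¬l) , λ {e} (us , ws , u , w , eq , p) → edges⊇ e us eq p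
      where
      verts⊇ : ∀ {v} → v ∈ interior → v U.∈ verts (pruneLeaves G)
      verts⊇ v∈ with ∈-applyUpTo⁻ _ v∈
      ... | i , i< , refl = ~⇒vertʳ (path-edge (<⇒≤ (<pred⇒ i<))) , interior-non-leaf (<pred⇒ i<)

      edges⊆ : ∀ e → B e → (∀ v → Incident v e → ¬ IsLeaf G v) →
        ∃₂ λ us ws → ∃₂ λ u w → interior ≡ us ++ u ∷ w ∷ ws × Joins e u w
      edges⊆ e e∈ ¬l with proj₁ B≐ e∈
      -- An edge whose upper end is `t` or beyond has a leaf there. The others are path edges, and
      -- the one with c = 0 starts at a leaf.
      ... | c , c<m , p with right c <? t
      ...   | no r≮t =
            contradiction (far-leaf c<m (≮⇒≥ r≮t)) (¬l _ (joins-incident e (joins-sym e p)))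
      ...   | yes r<t with ≤-<-trans (s≤s (m≤m+n c (δ c))) r<t
      ...     | c<t with c
      ...       | zero =
            contradiction (subst (λ i → IsLeaf G (W i)) (sym (left-flat 0<t)) start-leaf)
                           (¬l _ (joins-incident e p))
      ...       | suc i with applyUpTo-split (λ i → W (suc i)) (pred t) (⇒<pred c<t)
      ...         | us , ws , eq = us , ws , _ , _ , eq ,
        subst₂ (λ a b → Joins e (W a) (W b)) (left-flat (<⇒≤ c<t)) (right-flat (<⇒≤ c<t)) p

      edges⊇ : ∀ e us {u w ws} → interior ≡ us ++ u ∷ w ∷ ws → Joins e u w →
        B e × (∀ v → Incident v e → ¬ IsLeaf G v)
      edges⊇ e us eq p with applyUpTo-split⁻ (λ i → W (suc i)) (pred t) us eq
      ... | i , i< , refl , refl with <pred⇒ i<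
      ...   | 2+i<t = proj₂ B≐ (suc i , <-≤-trans (<⇒≤ 2+i<t) t≤m ,
          subst₂ (λ a b → Joins e (W a) (W b)) (sym (left-flat (<⇒≤ 2+i<t)))
            (sym (right-flat (<⇒≤ 2+i<t))) p) ,
        λ v i → [ (λ { refl → interior-non-leaf (<⇒≤ 2+i<t) }) ,
          (λ { refl → interior-non-leaf 2+i<t }) ]′ (incident-joins e p i)

    caterpillar : IsCaterpillar G
    caterpillar = tree , pruned-path

    spine : List (Fin n)
    spine = applyUpTo W (suc t)

    spine-path : IsPath G spine
    spine-path = (λ ()) ,
      All.applyUpTo⁺₁ W (suc t)
        (λ { {zero} _ → ~⇒vertˡ (path-edge 0<t) ; {suc i} (s≤s p) → ~⇒vertʳ (path-edge p) }) ,
      Unique.applyUpTo⁺₁ W (suc t) (λ i<j j< → W≢ i<j (≤-pred j<)) ,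
      Linked.applyUpTo⁺₁ W (suc t) (λ i< → path-edge (≤-pred i<))

    spine-length : pathLength spine ≡ t
    spine-length = cong pred (length-applyUpTo W (suc t))

    -- Apart from its two ends, a path consists of distinct vertices that are not leaves. There are
    -- t - 1 of these, so a path has at most t + 1 vertices.
    path-length≤ : ∀ ws → IsPath G ws → pathLength ws ≤ t
    path-length≤ ws (_ , a , u , k) = ≤-trans (pred-mono-≤ (length-inner ws))
      (subst (suc (length (inner ws)) ≤_) suc-pred-t
        (s≤s (subst (length (inner ws) ≤_) (length-applyUpTo _ (pred t))
        (unique⊆⇒length≤ (unique-inner ws u) λ v∈ →
          non-leaf⇒interior (All.lookup (inner-all ws a) v∈)
            (All.lookup (inner-non-leaf {G = G} ws u k) v∈)))))
      where
      inner-all : ∀ ws → All (U._∈ verts G) ws → All (U._∈ verts G) (inner ws)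
      inner-all []       []       = []
      inner-all (x ∷ ws) (_ ∷ a) = all-inner ws a

-- Three arcs of parallel edges

allPairs-lookup : ∀ {A : Set} {R : A → A → Set} → (∀ {x y} → R x y → R y x) →
  ∀ {xs} → AllPairs R xs → ∀ {x y} → x ∈ xs → y ∈ xs → x ≢ y → R x y
allPairs-lookup R-sym (r ∷ rs) (here refl) (here refl) x≢y = contradiction refl x≢y
allPairs-lookup R-sym (r ∷ rs) (here refl) (there q)   x≢y = All.lookup r q
allPairs-lookup R-sym (r ∷ rs) (there p)   (here refl) x≢y = R-sym (All.lookup r p)
allPairs-lookup R-sym (r ∷ rs) (there p)   (there q)   x≢y = allPairs-lookup R-sym rs p q x≢y

disjoint⇒≢ : ∀ {n} {e f : Edge n} → Disjoint e f → e ≢ f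
disjoint⇒≢ {e = e} (d , _) refl = d (lo e) (inj₁ refl , inj₁ refl)

module Matchings (m : ℕ) .{{_ : NonZero m}} where
  open Polygon m

  module _ (u : ℕ) where

    On : ℕ → ℕ → Edge n → Set
    On x y e = Joins e (V (u + x)) (V (u + y))

    chord : ∀ {x y} → x < y → y < n → ∃ (On x y)
    chord x<y y<n = join (λ p → <⇒≢ x<y (V-injective u (<-trans x<y y<n) y<n p))

    disjoint-chords : ∀ e f {x y z w} → x < y → y < n → z < w → w < n → On x y e → On z w f →
      x ≢ z → x ≢ w → y ≢ z → y ≢ w → ¬ Interlaced x y z w → Disjoint e f
    disjoint-chords e f {x} {y} {z} {w} x<y y<n z<w w<n p q x≢z x≢w y≢z y≢w ¬i =
      apart , λ c → ¬i (crosses⇒interlaced u e f x<y y<n z<w w<n p q c)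
      where
      x< = <-trans x<y y<n
      z< = <-trans z<w w<n
      apart : ∀ v → ¬ (Incident v e × Incident v f)
      apart v (i , j) with incident-joins e p i | incident-joins f q j
      ... | inj₁ a | inj₁ b = x≢z (V-injective u x< z< (trans (sym a) b))
      ... | inj₁ a | inj₂ b = x≢w (V-injective u x< w<n (trans (sym a) b))
      ... | inj₂ a | inj₁ b = y≢z (V-injective u y<n z< (trans (sym a) b))
      ... | inj₂ a | inj₂ b = y≢w (V-injective u y<n w<n (trans (sym a) b))

    nested : ∀ e f {x y z w} → x < z → z < w → w < y → y < n → On x y e → On z w f → Disjoint e f
    nested e f x<z z<w w<y y<n p q =
      disjoint-chords e f (<-trans x<z (<-trans z<w w<y)) y<n z<w (<-trans w<y y<n) p q
        (<⇒≢ x<z) (<⇒≢ (<-trans x<z z<w)) (≢-sym (<⇒≢ (<-trans z<w w<y))) (≢-sym (<⇒≢ w<y))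
        λ { (inj₁ (_ , _ , y<w)) → <-asym y<w w<y ; (inj₂ (z<x , _)) → <-asym z<x x<z }

    separate : ∀ e f {x y z w} → x < y → y < z → z < w → w < n → On x y e → On z w f →
      Disjoint e f
    separate e f x<y y<z z<w w<n p q =
      disjoint-chords e f x<y (<-trans y<z (<-trans z<w w<n)) z<w w<n p q
        (<⇒≢ (<-trans x<y y<z)) (<⇒≢ (<-trans x<y (<-trans y<z z<w))) (<⇒≢ y<z)
          (<⇒≢ (<-trans y<z z<w))
        λ { (inj₁ (_ , z<y , _)) → <-asym z<y y<z ; (inj₂ (z<x , _)) → <-asym z<x
          (<-trans x<y y<z) }

    inside : ∀ s r → s + (suc r + suc r) ≤ n → suc (s + (r + r)) < n
    inside s r h =
      linear 3 (λ s r n → s :+ (# 1 :+ r :+ (# 1 :+ r)) :≤ n ∷ [] ⊢ # 1 :+ (s :+ (r :+ r)) :< n)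
        s r n h

    outermost : ∀ s r → s + (suc r + suc r) ≤ n → ∃ (On s (suc (s + (r + r))))
    outermost s r h = chord (s≤s (m≤m+n s (r + r))) (inside s r h)

    -- The r pairwise parallel edges on the labels s, …, s + 2r - 1.
    arc : ∀ s r → s + (r + r) ≤ n → List (Edge n)
    arc s zero    _ = []
    arc s (suc r) h = proj₁ (outermost s r h) ∷ arc (suc s) r (<⇒≤ (inside s r h))

    length-arc : ∀ s r h → length (arc s r h) ≡ r
    length-arc s zero    h = refl
    length-arc s (suc r) h = cong suc (length-arc (suc s) r _)

    ∈-arc : ∀ s r h {e} → e ∈ arc s r h →
      ∃₂ λ x j → j < r × x + suc j ≡ s + r × On x (s + r + j) e
    ∈-arc s (suc r) h (here refl) = s , r , ≤-refl , refl ,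
      subst (λ y → On s y (proj₁ (outermost s r h)))
        (linear 2 (λ s r → [] ⊢ # 1 :+ (s :+ (r :+ r)) :≡ s :+ (# 1 :+ r) :+ r) s r)
        (proj₂ (outermost s r h))
    ∈-arc s (suc r) h {e} (there e∈) with ∈-arc (suc s) r _ e∈
    ... | x , j , j<r , eq , p = x , j , m≤n⇒m≤1+n j<r , trans eq (sym (+-suc s r)) ,
      subst (λ y → On x (y + j) e) (sym (+-suc s r)) p

    arc-range : ∀ s r h {e} → e ∈ arc s r h →
      ∃₂ λ x y → s ≤ x × x < y × y < s + (r + r) × On x y e
    arc-range s r h e∈ with ∈-arc s r h e∈
    ... | x , j , j<r , eq , p = x , s + r + j ,
      linear 4 (λ s r x j → x :+ (# 1 :+ j) :≡ s :+ r ∷ j :< r ∷ [] ⊢ s :≤ x) s r x j eq j<r ,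
      linear 4 (λ s r x j → x :+ (# 1 :+ j) :≡ s :+ r ∷ [] ⊢ x :< s :+ r :+ j) s r x j eq ,
      linear 3 (λ s r j → j :< r ∷ [] ⊢ s :+ r :+ j :< s :+ (r :+ r)) s r j j<r , p

    arc-disjoint : ∀ s r h → AllPairs Disjoint (arc s r h)
    arc-disjoint s zero    h = []
    arc-disjoint s (suc r) h = All.tabulate outer ∷ arc-disjoint (suc s) r _
      where
      e = proj₁ (outermost s r h)
      outer : ∀ {f} → f ∈ arc (suc s) r _ → Disjoint e f
      outer {f} f∈ with arc-range (suc s) r _ f∈
      ... | z , w , s<z , z<w , w< , q =
            nested e f s<z z<w w< (inside s r h) (proj₂ (outermost s r h)) q

    arcs-disjoint : ∀ s r h s′ r′ h′ → s + (r + r) ≤ s′ →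
      All (λ e → All (Disjoint e) (arc s′ r′ h′)) (arc s r h)
    arcs-disjoint s r h s′ r′ h′ le = All.tabulate λ {e} e∈ → All.tabulate λ {f} f∈ → go e f e∈ f∈
      where
      go : ∀ e f → e ∈ arc s r h → f ∈ arc s′ r′ h′ → Disjoint e f
      go e f e∈ f∈ with arc-range s r h e∈ | arc-range s′ r′ h′ f∈
      ... | x , y , _ , x<y , y< , p | z , w , s′≤z , z<w , w< , q =
        separate e f x<y (<-≤-trans y< (≤-trans le s′≤z)) z<w (<-≤-trans w< h′) p q

    -- Counted from `u`, the arcs occupy the labels 0 and 1, then 2, ..., 2r + 1, then 2r + 2, ...,
    -- 2m - 1. Their centres are `u`, u + r + 1 and u + r + m, so the last two arcs belong to
    -- neighbouring directions.
    module ThreeArcs (r r′ : ℕ) (eq : suc (r + r′) ≡ m) where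

      bound₁ : 0 + (1 + 1) ≤ n
      bound₁ = linear 4 (λ r r′ m n → # 1 :+ (r :+ r′) :≡ m ∷ n :≡ m :+ m ∷ [] ⊢ # 2 :≤ n)
        r r′ m n eq n≡

      bound₂ : 2 + (r + r) ≤ n
      bound₂ = linear 4 (λ r r′ m n → # 1 :+ (r :+ r′) :≡ m ∷ n :≡ m :+ m ∷ []
        ⊢ # 2 :+ (r :+ r) :≤ n) r r′ m n eq n≡

      bound₃ : 2 + (r + r) + (r′ + r′) ≤ n
      bound₃ = linear 4 (λ r r′ m n → # 1 :+ (r :+ r′) :≡ m ∷ n :≡ m :+ m ∷ []
        ⊢ # 2 :+ (r :+ r) :+ (r′ :+ r′) :≤ n) r r′ m n eq n≡

      arc₁ arc₂ arc₃ three-arcs : List (Edge n)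
      arc₁ = arc 0 1 bound₁
      arc₂ = arc 2 r bound₂
      arc₃ = arc (2 + (r + r)) r′ bound₃
      three-arcs = arc₁ ++ arc₂ ++ arc₃

      three-arcs-disjoint : AllPairs Disjoint three-arcs
      three-arcs-disjoint = AllPairs.++⁺ (arc-disjoint 0 1 bound₁)
        (AllPairs.++⁺ (arc-disjoint 2 r bound₂) (arc-disjoint _ r′ bound₃)
          (arcs-disjoint 2 r bound₂ _ r′ bound₃ ≤-refl))
        (All.tabulate λ e∈ → All.++⁺
          (All.lookup (arcs-disjoint 0 1 bound₁ 2 r bound₂ ≤-refl) e∈)
          (All.lookup (arcs-disjoint 0 1 bound₁ _ r′ bound₃ (s≤s (s≤s z≤n))) e∈))

      length-three-arcs : length three-arcs ≡ m
      length-three-arcs = trans (cong suc (trans (length-++ arc₂)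
        (cong₂ _+_ (length-arc 2 r bound₂) (length-arc _ r′ bound₃)))) eq

      three-arcs-spm : IsSPM m (_∈ three-arcs)
      three-arcs-spm =
        (three-arcs , length-three-arcs , AllPairs.map disjoint⇒≢ three-arcs-disjoint ,
          (λ p → p) , (λ p → p)) ,
        λ e f e∈ f∈ → allPairs-lookup (λ {e} {f} → disjoint-sym e f) three-arcs-disjoint e∈ f∈

  -- Centre, radius and direction of an edge

  -- The edge e is the segment [c - j, c + 1 + j].
  Centred : ℕ → ℕ → Edge n → Set
  Centred c j e = ∃[ x ] x + j ≡ c + n × Joins e (V x) (V (suc c + j))

  -- Opaque, like some later proofs: otherwise a with-abstraction over an
  -- instance normalises the whole proof.
  opaque

    arc-centred : ∀ u s r h {c e} → suc c ≡ u + (s + r) → e ∈ arc u s r h →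
      ∃[ j ] j < r × Centred c j e
    arc-centred u s r h {c} {e} eq e∈ with ∈-arc u s r h e∈
    ... | x , j , j<r , eq′ , p = j , j<r , u + x + n ,
      linear 7 (λ u s r c x j n → # 1 :+ c :≡ u :+ (s :+ r) ∷ x :+ (# 1 :+ j) :≡ s :+ r ∷ []
        ⊢ u :+ x :+ n :+ j :≡ c :+ n)
        u s r c x j n eq eq′ ,
      subst₂ (Joins e) (sym (V-period (u + x)))
        (cong V (trans (sym (+-assoc u (s + r) j)) (cong (_+ j) (sym eq)))) p

  -- When j + j′ = m - 1 the two descriptions of the segment differ by exchanging its ends and by
  -- multiples of 2m.
  antipode : ∀ {c j j′ e} → suc (j + j′) ≡ m → Centred (c + m) j e → Centred c j′ e
  antipode {c} {j} {j′} {e} eq (x , eq′ , p) = suc (c + m) + j ,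
    linear 5 (λ c j j′ m n → # 1 :+ (j :+ j′) :≡ m ∷ n :≡ m :+ m ∷ []
      ⊢ # 1 :+ (c :+ m) :+ j :+ j′ :≡ c :+ n) c j j′ m n eq n≡ ,
    joins-sym e (subst (λ v → Joins e v _) (trans (cong V x≡) (V-period (suc c + j′))) p)
    where
    x≡ : x ≡ suc c + j′ + n
    x≡ = linear 6 (λ c j j′ m n x → # 1 :+ (j :+ j′) :≡ m ∷ x :+ j :≡ c :+ m :+ n ∷ []
      ⊢ x :≡ # 1 :+ c :+ j′ :+ n) c j j′ m n x eq eq′

  -- If the ends agreed crosswise, j + k + 1 would be 2m, which is too much for two radii below `m`.
  radius-unique : ∀ {c j k} e → j < m → k < m → Centred c j e → Centred c k e → j ≡ k
  radius-unique {c} {j} {k} e j<m k<m (x , eq , p) (x′ , eq′ , q) with joins-ends e p q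
  ... | inj₁ (_ , b) = V-injective (suc c) (<m⇒<n j<m) (<m⇒<n k<m) b
    where
    <m⇒<n : ∀ {i} → i < m → i < n
    <m⇒<n i<m = ≤-trans i<m (m≤m+n m _)
  ... | inj₂ (a , _) with m≤n⇒∃[o]m+o≡n (≤-trans j<m (m≤m+n m (m + 0)))
  ...   | i , j+i≡n = ⊥-elim
        (linear 4 (λ j k m n → # 1 :+ (j :+ k) :≡ n ∷ n :≡ m :+ m ∷ j :< m ∷ k :< m ∷ [] ⊢ :⊥)
          j k m n
      (trans (cong (λ i → suc j + i) (sym i≡k)) j+i≡n) n≡ j<m k<m)
    where
    i≡k : i ≡ k
    i≡k = V-injective (suc c)
      (linear 3 (λ j i n → # 1 :+ (j :+ i) :≡ n ∷ [] ⊢ i :< n) j i n j+i≡n)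
      (≤-trans k<m (m≤m+n m _))
      (trans (cong V
        (linear 5 (λ c j i n x → # 1 :+ (j :+ i) :≡ n ∷ x :+ j :≡ c :+ n ∷ []
          ⊢ # 1 :+ c :+ i :≡ x) c j i n x j+i≡n eq)) a)

  -- Two edges are parallel when the sums of their end labels agree modulo 2m. An edge with centre c
  -- has the sum 2c + 1, so the centres c and c + m share a direction.
  direction : Edge n → ℕ
  direction e = (toℕ (lo e) + toℕ (hi e)) % n

  V-+ : ∀ i j → (toℕ (V i) + toℕ (V j)) % n ≡ (i + j) % n
  V-+ i j rewrite toℕ-V i | toℕ-V j = sym (%-distribˡ-+ i j n)

  joins-direction : ∀ e {i j} → Joins e (V i) (V j) → direction e ≡ (i + j) % n
  joins-direction e {i} {j} (inj₁ (p , q)) =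
    trans (cong₂ (λ u v → (toℕ u + toℕ v) % n) p q) (V-+ i j)
  joins-direction e {i} {j} (inj₂ (p , q)) =
    trans (cong₂ (λ u v → (toℕ u + toℕ v) % n) p q) (trans (V-+ j i) (cong (_% n) (+-comm j i)))

  centred-direction : ∀ {c j} e → Centred c j e → direction e ≡ (suc (c + c)) % n
  centred-direction {c} {j} e (x , eq , p) = trans (joins-direction e p)
    (trans (cong (_% n) {x + (suc c + j)}
      (linear 4 (λ c j n x → x :+ j :≡ c :+ n ∷ []
        ⊢ x :+ (# 1 :+ c :+ j) :≡ # 1 :+ (c :+ c) :+ n) c j n x eq))
      ([m+n]%n≡m%n (suc (c + c)) n))

  direction-injective : ∀ s {i j} → i < m → j < m →
    (suc ((s + i) + (s + i))) % n ≡ (suc ((s + j) + (s + j))) % n → i ≡ j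
  direction-injective s {i} {j} i<m j<m eq = linear 2 (λ i j → i :+ i :≡ j :+ j ∷ [] ⊢ i :≡ j) i j
    (V-injective (suc (s + s)) (double i<m) (double j<m)
      (V-cong {suc (s + s) + (i + i)} {suc (s + s) + (j + j)}
        (trans (cong (_% n) (shuffle i)) (trans eq (cong (_% n) (sym (shuffle j)))))))
    where
    double : ∀ {i} → i < m → i + i < n
    double {i} p = linear 3 (λ i m n → i :< m ∷ n :≡ m :+ m ∷ [] ⊢ i :+ i :< n) i m n p n≡
    shuffle : ∀ i → suc (s + s) + (i + i) ≡ suc ((s + i) + (s + i))
    shuffle i =
      linear 2 (λ s i → [] ⊢ # 1 :+ (s :+ s) :+ (i :+ i) :≡ # 1 :+ ((s :+ i) :+ (s :+ i))) s i

-- The shape of a blocker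

module Blocker (m : ℕ) .{{_ : NonZero m}} (2≤m : 2 ≤ m)
  (B : Pred (Edge (2 * m)) 0ℓ) (blocker : IsBlocker m B) where
  open Polygon m
  open Matchings m

  opaque

    hit : ∀ u r r′ (eq : suc (r + r′) ≡ m) → ∃[ e ] B e ×
      (e ∈ ThreeArcs.arc₁ u r r′ eq ⊎ e ∈ ThreeArcs.arc₂ u r r′ eq ⊎ e ∈ ThreeArcs.arc₃ u r r′ eq)
    hit u r r′ eq with proj₁ blocker _ (ThreeArcs.three-arcs-spm u r r′ eq)
    ... | e , e∈B , e∈ with ∈-++⁻ (ThreeArcs.arc₁ u r r′ eq) e∈
    ...   | inj₁ p = e , e∈B , inj₁ p
    ...   | inj₂ q with ∈-++⁻ (ThreeArcs.arc₂ u r r′ eq) q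
    ...     | inj₁ p = e , e∈B , inj₂ (inj₁ p)
    ...     | inj₂ p = e , e∈B , inj₂ (inj₂ p)

  complement : ∀ {j} → j < m → ∃[ k ] suc (j + k) ≡ m
  complement j<m = m≤n⇒∃[o]m+o≡n j<m

  complement< : ∀ {j k} → suc (j + k) ≡ m → k < m
  complement< {j} {k} eq = subst (k <_) eq (s≤s (m≤n+m k j))

  0<m : 0 < m
  0<m = <⇒≤ 2≤m

  opaque

    -- For r = 0 the middle arc is empty and the matching consists of all `m` edges of one
    -- direction: the boundary edge with centre `c` and the nested edges with centre c + m, which
    -- are then described from `c`.
    chosen : ∀ c → ∃[ j ] j < m × ∃[ e ] B e × Centred c j e
    chosen c with complement 0<m
    ... | k , eq with hit c 0 k eq
    ...   | e , e∈ , inj₁ p with arc-centred c 0 1 (ThreeArcs.bound₁ c 0 k eq)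
          (sym (+-comm c 1)) p
    ...     | .0 , s≤s z≤n , q = 0 , 0<m , e , e∈ , q
    chosen c | k , eq | e , e∈ , inj₂ (inj₂ p)
      with arc-centred c 2 k (ThreeArcs.bound₃ c 0 k eq) {c + m}
        (linear 3 (λ c m k → # 1 :+ k :≡ m ∷ [] ⊢ # 1 :+ (c :+ m) :≡ c :+ (# 2 :+ k)) c m k eq) p
    ... | j , j<k , q with complement (<-trans j<k (complement< eq))
    ...   | j′ , eq′ = j′ , complement< eq′ , e , e∈ , antipode {e = e} eq′ q

  ε : ℕ → ℕ
  ε c = proj₁ (chosen c)

  ε<m : ∀ c → ε c < m
  ε<m c = proj₁ (proj₂ (chosen c))

  blockerEdge : ℕ → Edge n
  blockerEdge c = proj₁ (proj₂ (proj₂ (chosen c)))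

  blockerEdge∈ : ∀ c → B (blockerEdge c)
  blockerEdge∈ c = proj₁ (proj₂ (proj₂ (proj₂ (chosen c))))

  blockerEdge-centred : ∀ c → Centred c (ε c) (blockerEdge c)
  blockerEdge-centred c = proj₂ (proj₂ (proj₂ (proj₂ (chosen c))))

  blockerEdge-injective : ∀ s {i j} → i < m → j < m → ∀ {e f} →
    e ≡ blockerEdge (s + i) → f ≡ blockerEdge (s + j) → direction e ≡ direction f → i ≡ j
  blockerEdge-injective s {i} {j} i<m j<m refl refl eq = direction-injective s i<m j<m
    (trans (sym (centred-direction (blockerEdge (s + i)) (blockerEdge-centred (s + i))))
      (trans eq (centred-direction (blockerEdge (s + j)) (blockerEdge-centred (s + j)))))

  blockerEdges : ℕ → List (Edge n)
  blockerEdges s = tabulate {n = m} (λ i → blockerEdge (s + toℕ i))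

  blockerEdges-unique : ∀ s → Unique (blockerEdges s)
  blockerEdges-unique s = Unique.tabulate⁺ λ {i} {j} eq →
    toℕ-injective (blockerEdge-injective s (toℕ<n i) (toℕ<n j) refl refl (cong direction eq))

  blockerEdges⊆ : ∀ s {e} → e ∈ blockerEdges s → B e
  blockerEdges⊆ s e∈ with ∈-tabulate⁻ {n = m} e∈
  ... | i , refl = blockerEdge∈ (s + toℕ i)

  -- B has one edge in each of the m directions and only m edges in total.
  blockerEdges⊇ : ∀ s {e} → B e → e ∈ blockerEdges s
  blockerEdges⊇ s e∈ with proj₂ blocker
  ... | es , len , _ , B⊆ , _ = unique⊆⇒⊇ _≟ₑ_ (blockerEdges-unique s)
    (λ x∈ → B⊆ (blockerEdges⊆ s x∈))
    (≤-reflexive (trans len (sym (length-tabulate {n = m} (λ i → blockerEdge (s + toℕ i))))))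
    (B⊆ e∈)

  blockerEdge-surjective : ∀ s {e} → B e → ∃[ i ] i < m × e ≡ blockerEdge (s + i)
  blockerEdge-surjective s e∈ with ∈-tabulate⁻ {n = m} (blockerEdges⊇ s e∈)
  ... | i , eq = toℕ i , toℕ<n i , eq

  -- Every edge of `B` is one of the `m` chosen ones, and these have different directions. Hence `e`
  -- and `blockerEdge c` coincide, and with them their radii.
  ε-unique : ∀ {c j} e → B e → j < m → Centred c j e → j ≡ ε c
  ε-unique {c} e e∈ j<m p with blockerEdge-surjective 0 e∈ | blockerEdge-surjective 0
    (blockerEdge∈ c)
  ... | i , i<m , eq | k , k<m , eq′
    with blockerEdge-injective 0 i<m k<m eq eq′
           (trans (centred-direction e p)
             (sym (centred-direction (blockerEdge c) (blockerEdge-centred c))))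
  ...   | refl = radius-unique e j<m (ε<m c) p
          (subst (Centred c (ε c)) (trans eq′ (sym eq)) (blockerEdge-centred c))

  -- Described from `c`, the edge chosen at c + m has the complementary radius and is still an edge
  -- of `B`.
  ε-antipode : ∀ c → suc (ε (c + m) + ε c) ≡ m
  ε-antipode c with complement (ε<m (c + m))
  ... | j , eq = trans (cong (λ j → suc (ε (c + m) + j)) (sym j≡)) eq
    where
    j≡ : j ≡ ε c
    j≡ = ε-unique (blockerEdge (c + m)) (blockerEdge∈ (c + m)) (complement< eq)
      (antipode {e = blockerEdge (c + m)} eq (blockerEdge-centred (c + m)))

  ε-period : ∀ c → ε (c + n) ≡ ε c
  ε-period c = trans (cong ε (trans (cong (λ z → c + z) n≡) (sym (+-assoc c m m))))
    (linear 4 (λ a b d m → # 1 :+ (a :+ b) :≡ m ∷ # 1 :+ (b :+ d) :≡ m ∷ [] ⊢ a :≡ d)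
      (ε (c + m + m)) (ε (c + m)) (ε c) m (ε-antipode (c + m)) (ε-antipode c))

  opaque

    -- `B` meets one of the three arcs, and the radii within an arc are below the number of its
    -- edges.
    ε-three : ∀ u r r′ → suc (r + r′) ≡ m → ε u ≡ 0 ⊎ ε (suc (u + r)) < r ⊎ ε (u + r + m) < r′
    ε-three u r r′ eq with hit u r r′ eq
    ... | e , e∈ , inj₁ p with arc-centred u 0 1 (ThreeArcs.bound₁ u r r′ eq) (sym (+-comm u 1)) p
    ...   | .0 , s≤s z≤n , q = inj₁ (sym (ε-unique e e∈ 0<m q))
    ε-three u r r′ eq | e , e∈ , inj₂ (inj₁ p)
      with arc-centred u 2 r (ThreeArcs.bound₂ u r r′ eq)
        (linear 2 (λ u r → [] ⊢ # 2 :+ (u :+ r) :≡ u :+ (# 2 :+ r)) u r) p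
    ... | j , j<r , q = inj₂ (inj₁ (subst (_< r)
      (ε-unique e e∈ (<-trans j<r (subst (r <_) eq (s≤s (m≤m+n r r′)))) q) j<r))
    ε-three u r r′ eq | e , e∈ , inj₂ (inj₂ p)
      with arc-centred u (2 + (r + r)) r′ (ThreeArcs.bound₃ u r r′ eq) {u + r + m}
        (linear 4 (λ u r r′ m → # 1 :+ (r :+ r′) :≡ m ∷ []
          ⊢ # 1 :+ (u :+ r :+ m) :≡ u :+ (# 2 :+ (r :+ r) :+ r′)) u r r′ m eq) p
    ... | j , j<r′ , q =
          inj₂ (inj₂ (subst (_< r′) (ε-unique e e∈ (<-trans j<r′ (complement< eq)) q) j<r′))

  -- For u = c - r modulo 2m the two large arcs have centres c + 1 and c + m. The bounds on `r` say
  -- exactly that the edges of `B` with these centres are too long for the arcs, so the boundary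
  -- edge at `u` is hit.
  ε-up : ∀ {c r u} → u + r ≡ c + n → ε c ≤ r → r ≤ ε (suc c) → ε u ≡ 0
  ε-up {c} {r} {u} eq ≤r r≤ with complement (≤-<-trans r≤ (ε<m (suc c)))
  ... | r′ , eq′ with ε-three u r r′ eq′
  ...   | inj₁ p = p
  ...   | inj₂ (inj₁ p) = contradiction p (≤⇒≯ (subst (r ≤_)
          (sym (trans (cong (λ z → ε (suc z)) eq) (ε-period (suc c)))) r≤))
  ...   | inj₂ (inj₂ p) = ⊥-elim (linear 5 (λ a b r r′ m →
          a :< r′ ∷ # 1 :+ (a :+ b) :≡ m ∷ b :≤ r ∷ # 1 :+ (r :+ r′) :≡ m ∷ [] ⊢ :⊥)
          (ε (u + r + m)) (ε (u + r)) r r′ m p (ε-antipode (u + r))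
          (subst (_≤ r) (sym (trans (cong ε eq) (ε-period c))) ≤r) eq′)

  -- The mirror image: the boundary edge has centre c + 1 + r, and the arcs of `r′` and `r` edges
  -- have centres c + 1 + m and `c`, up to multiples of 2m.
  ε-down : ∀ {c r} → ε (suc c) ≤ r → r ≤ ε c → ε (suc (c + r)) ≡ 0
  ε-down {c} {r} ≤r r≤ with complement (≤-<-trans r≤ (ε<m c))
  ... | r′ , eq with ε-three (suc (c + r)) r′ r (trans (cong suc (+-comm r′ r)) eq)
  ...   | inj₁ p = p
  ...   | inj₂ (inj₁ p) = ⊥-elim (linear 5 (λ a b r r′ m →
          a :< r′ ∷ # 1 :+ (a :+ b) :≡ m ∷ b :≤ r ∷ # 1 :+ (r :+ r′) :≡ m ∷ [] ⊢ :⊥)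
          (ε (suc c + m)) (ε (suc c)) r r′ m
          (subst (λ z → ε z < r′)
            (linear 4 (λ c r r′ m → # 1 :+ (r :+ r′) :≡ m ∷ []
              ⊢ # 2 :+ (c :+ r) :+ r′ :≡ # 1 :+ c :+ m) c r r′ m eq) p)
          (ε-antipode (suc c)) ≤r eq)
  ...   | inj₂ (inj₂ p) = contradiction (subst (_< r)
          (trans (cong ε
            (linear 5 (λ c r r′ m n → # 1 :+ (r :+ r′) :≡ m ∷ n :≡ m :+ m ∷ []
              ⊢ # 1 :+ (c :+ r) :+ r′ :+ m :≡ c :+ n) c r r′ m n eq n≡)) (ε-period c)) p)
          (≤⇒≯ r≤)

  -- Whichever way the radii at the centres 0 and 1 compare, one of the two rules applies to the
  -- smaller radius.
  some-zero : ∃[ z ] ε z ≡ 0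
  some-zero with ≤-total (ε 0) (ε 1)
  ... | inj₁ p = _ , ε-up {0} {ε 0} (m∸n+n≡m (≤-trans (<⇒≤ (ε<m 0)) (m≤m+n m _))) ≤-refl p
  ... | inj₂ p = _ , ε-down {0} {ε 1} ≤-refl p

  -- The profile of a blocker

  Rise : ℕ → ℕ → Set
  Rise p l = ε p ≡ 0 × suc (ε (p + l)) ≡ m ×
    (∀ {i} → 0 < i → i < l → 0 < ε (p + i) × suc (ε (p + i)) < m)

  -- An inner zero becomes the new start and an inner value m - 1 the new end. The interval shrinks
  -- each time, and `b` bounds its length.
  find-rise : ∀ b d → d ≤ b → ∀ p → ε p ≡ 0 → suc (ε (p + d)) ≡ m → ∃₂ λ p′ l → l ≤ d × Rise p′ l
  find-rise b d d≤b p ε≡0 top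
    with anyUpTo? (λ i → (0 <? i) ×-dec ((ε (p + i) ≟ 0) ⊎-dec (suc (ε (p + i)) ≟ m))) d
  ... | no ¬i = p , d , ≤-refl , ε≡0 , top , λ {i} 0<i i<d →
      n≢0⇒n>0 (λ eq → ¬i (i , i<d , 0<i , inj₁ eq)) ,
      ≤∧≢⇒< (ε<m (p + i)) (λ eq → ¬i (i , i<d , 0<i , inj₂ eq))
  find-rise (suc b) d d≤b p ε≡0 top | yes (i , i<d , 0<i , inj₁ zero-i) with m≤n⇒∃[o]m+o≡n
    (<⇒≤ i<d)
  ... | d′ , refl with find-rise b d′
          (linear 3 (λ i d b → # 0 :< i ∷ i :+ d :≤ # 1 :+ b ∷ [] ⊢ d :≤ b) i d′ b 0<i d≤b)
          (p + i) zero-i (trans (cong (λ z → suc (ε z)) (+-assoc p i d′)) top)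
  ...   | p′ , l , l≤ , rise = p′ , l , ≤-trans l≤ (m≤n+m d′ i) , rise
  find-rise (suc b) d d≤b p ε≡0 top | yes (i , i<d , 0<i , inj₂ top-i)
    with find-rise b i (≤-pred (≤-trans i<d d≤b)) p ε≡0 top-i
  ... | p′ , l , l≤ , rise = p′ , l , ≤-trans l≤ (<⇒≤ i<d) , rise
  find-rise zero d d≤b p ε≡0 top | yes (i , i<d , _) = contradiction (≤-trans i<d d≤b) λ ()

  module FromRise {p l k : ℕ} (l+k : l + k ≡ m) (rise : Rise p l) where

    -- This is q - m modulo 2m for q = p + l, written without subtraction. Counted from here, `p`
    -- has the label `k`.
    start : ℕ
    start = p + l + m

    δ : ℕ → ℕ
    δ c = ε (start + c)

    shift : ∀ i → start + (k + i) ≡ p + i + n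
    shift i =
      linear 6 (λ p l k i m n → l :+ k :≡ m ∷ n :≡ m :+ m ∷ []
        ⊢ p :+ l :+ m :+ (k :+ i) :≡ p :+ i :+ n) p l k i m n l+k n≡

    δ-shift : ∀ i → δ (k + i) ≡ ε (p + i)
    δ-shift i = trans (cong ε (shift i)) (ε-period (p + i))

    δ0 : δ 0 ≡ 0
    δ0 = linear 3 (λ a b m → # 1 :+ (a :+ b) :≡ m ∷ # 1 :+ b :≡ m ∷ [] ⊢ a :≡ # 0) (δ 0)
      (ε (p + l)) m
      (subst (λ z → suc (ε z + ε (p + l)) ≡ m) (sym (+-identityʳ start)) (ε-antipode (p + l)))
      (proj₁ (proj₂ rise))

    between : ∀ {c} → k < c → c < m → 0 < δ c × suc (δ c) < m
    between {c} k<c c<m with m≤n⇒∃[o]m+o≡n (<⇒≤ k<c)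
    ... | i , refl rewrite δ-shift i = proj₂ (proj₂ rise)
      (linear 2 (λ k i → k :< k :+ i ∷ [] ⊢ # 0 :< i) k i k<c)
      (linear 4 (λ k i l m → k :+ i :< m ∷ l :+ k :≡ m ∷ [] ⊢ i :< l) k i l m c<m l+k)

    -- Between p and p + l the value ε has to pass the line of slope one which
    -- makes c one of the zeros supplied by ε-up.
    zeros : ∀ d i {c j} → i + d ≡ l → c + j ≡ k → 0 < c → ε (p + i) < i + j → δ c ≡ 0
    zeros zero i {c} {j} refl c+j 0<c h = ⊥-elim (linear 6 (λ i c j k e m →
      e :< i :+ j ∷ # 1 :+ e :≡ m ∷ i :+ # 0 :+ k :≡ m ∷ c :+ j :≡ k ∷ # 0 :< c ∷ [] ⊢ :⊥)
        i c j k _ m h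
      (subst (λ z → suc (ε (p + z)) ≡ m) (+-identityʳ i) (proj₁ (proj₂ rise))) l+k c+j 0<c)
    zeros (suc d) i {c} {j} eq c+j 0<c h with i + j ≤? ε (suc (p + i))
    ... | yes q = ε-up {p + i} {i + j}
          (trans (linear 5 (λ s c i j k → c :+ j :≡ k ∷ []
            ⊢ s :+ c :+ (i :+ j) :≡ s :+ (k :+ i)) start c i j k c+j) (shift i))
          (<⇒≤ h) q
    ... | no q = zeros d (suc i) (trans (sym (+-suc i d)) eq) c+j 0<c
          (subst (λ z → ε z < suc i + j) (sym (+-suc p i)) (m≤n⇒m≤1+n (≰⇒> q)))

    flat : ∀ {c} → c ≤ k → δ c ≡ 0
    flat {zero} _ = δ0
    flat {suc c} c≤k with m≤n⇒m<n∨m≡n c≤k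
    ... | inj₂ refl = trans (trans (cong δ (sym (+-identityʳ k))) (δ-shift 0))
                        (trans (cong ε (+-identityʳ p)) (proj₁ rise))
    ... | inj₁ c<k with m≤n⇒∃[o]m+o≡n c<k
    ...   | j , eq = zeros l 0 refl (trans (+-suc (suc c) j) eq) (s≤s z≤n)
              (subst (λ z → ε z < suc j) (sym (+-identityʳ p))
                (subst (_< suc j) (sym (proj₁ rise)) (s≤s z≤n)))

    suc-δ<m : ∀ {c} → c < m → suc (δ c) < m
    suc-δ<m {c} c<m with c ≤? k
    ... | yes c≤k rewrite flat c≤k = 2≤m
    ... | no c≰k = proj₂ (between (≰⇒> c≰k) c<m)

    -- At the labels from `m` on, the radius is m - 1 minus that of the opposite centre, which stays
    -- below m - 1. The range extends to 2m because `incr` needs it at a label that may exceed `m`.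
    positive : ∀ {c} → k < c → c < m + m → 0 < δ c
    positive {c} k<c c<n with c <? m
    ... | yes c<m = proj₁ (between k<c c<m)
    ... | no c≮m with m≤n⇒∃[o]m+o≡n (≮⇒≥ c≮m)
    ...   | i , refl = linear 3 (λ a b m → # 1 :+ (a :+ b) :≡ m ∷ # 1 :+ b :< m ∷ [] ⊢ # 0 :< a)
          (δ (m + i)) (δ i) m
      (subst (λ z → suc (ε z + δ i) ≡ m)
        (linear 3 (λ s i m → [] ⊢ s :+ i :+ m :≡ s :+ (m :+ i)) start i m)
          (ε-antipode (start + i)))
      (suc-δ<m (+-cancelˡ-< m i m c<n))

    -- Without an increase, `ε-down` would produce a zero at the label c + 1 + r, strictly between
    -- `k` and 2m, where every radius is positive.
    incr : ∀ {c} → k ≤ c → suc c < m → δ c < δ (suc c)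
    incr {c} k≤c c<m with δ c <? δ (suc c)
    ... | yes p = p
    ... | no p = contradiction
          (subst (λ z → ε z ≡ 0)
            (linear 3 (λ s c r → [] ⊢ # 1 :+ (s :+ c :+ r) :≡ s :+ (# 1 :+ c :+ r)) start c r)
            (ε-down {start + c} {r} (≤-reflexive (cong ε (sym (+-suc start c)))) (≮⇒≥ p)))
          (≢-sym (<⇒≢ (positive (s≤s (≤-trans k≤c (m≤m+n c r)))
            (linear 3 (λ c r m → # 1 :+ c :< m ∷ r :< m ∷ [] ⊢ # 1 :+ c :+ r :< m :+ m)
              c r m c<m (ε<m (start + suc c))))))
      where
      r = δ (suc c)

    grows : ∀ i {c} → k ≤ c → c + i < m → δ c + i ≤ δ (c + i)
    grows zero {c} _ _ rewrite +-identityʳ c = ≤-reflexive (+-identityʳ (δ c))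
    grows (suc i) {c} k≤c c<m rewrite +-suc c i | +-suc (δ c) i =
      ≤-<-trans (grows i k≤c (<⇒≤ c<m)) (incr (≤-trans k≤c (m≤m+n c i)) c<m)

    -- Between `c` and m - 1 the radius gains at least m - 1 - c, and at m - 1 it is still below m -
    -- 1.
    below : ∀ {c} → k ≤ c → c < m → 0 < c → δ c < c
    below {c} k≤c c<m 0<c with complement c<m
    ... | i , eq =
          linear 5 (λ c i m d e → # 1 :+ (c :+ i) :≡ m ∷ d :+ i :≤ e ∷ # 1 :+ e :< m ∷ []
            ⊢ d :< c)
      c i m (δ c) (δ (c + i)) eq (grows i k≤c (≤-reflexive eq)) (suc-δ<m (≤-reflexive eq))

    -- For k = 0 the radius would grow strictly from 0 at the label 0 and reach at least m - 1 at
    -- the label m - 1.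
    0<k : 0 < k
    0<k = n≢0⇒n>0 λ k≡0 → absurd k≡0 (complement 2≤m)
      where
      absurd : k ≡ 0 → ∃[ i ] suc (1 + i) ≡ m → ⊥
      absurd k≡0 (i , eq) =
        linear 3 (λ i e m → # 2 :+ i :≡ m ∷ # 1 :+ i :≤ e ∷ # 1 :+ e :< m ∷ [] ⊢ :⊥) i
          (δ (suc i)) m eq
        (subst (λ z → z + suc i ≤ δ (suc i)) δ0
          (grows (suc i) {0} (≤-reflexive k≡0) (≤-reflexive eq)))
        (suc-δ<m (≤-reflexive eq))

    0<l : 0 < l
    0<l = n≢0⇒n>0 λ l≡0 → linear 2 (λ e m → # 1 :+ e :≡ m ∷ e :≡ # 0 ∷ # 2 :≤ m ∷ [] ⊢ :⊥) (ε p) m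
      (subst (λ z → suc (ε z) ≡ m) (trans (cong (λ z → p + z) l≡0) (+-identityʳ p))
        (proj₁ (proj₂ rise))) (proj₁ rise) 2≤m

    -- The zeros at the labels 0, ..., k are the path edges, so their number is k + 1.
    profile : Profile m (suc k) δ
    profile = record
      { 2≤t  = s≤s 0<k
      ; t≤m  = linear 3 (λ k l m → # 0 :< l ∷ l :+ k :≡ m ∷ [] ⊢ # 1 :+ k :≤ m) k l m 0<l l+k
      ; flat = λ c<t → flat (≤-pred c<t)
      ; low  = λ k<c c<m → below (<⇒≤ k<c) c<m (≤-<-trans z≤n k<c)
      ; high = λ k<c c<m → high (<⇒≤ k<c) c<m
      ; incr = λ t≤ c<m → incr (≤-pred t≤) c<m
      }
      where
      high : ∀ {c} → k ≤ c → c < m → c < suc k + δ c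
      high k≤c c<m with m≤n⇒∃[o]m+o≡n k≤c
      ... | i , refl = s≤s (+-monoʳ-≤ k (≤-trans (m≤n+m i (δ k)) (grows i ≤-refl c<m)))

    open Profile profile using (left; right; left+δ)

    centred⇒on : ∀ {c} e → c < m → Centred (start + c) (δ c) e → OnProfile profile start c e
    centred⇒on {c} e c<m (x , eq , p) = subst₂ (Joins e)
      (trans (cong V
        (linear 6 (λ s c d l x n → x :+ d :≡ s :+ c :+ n ∷ l :+ d :≡ c ∷ [] ⊢ x :≡ s :+ l :+ n)
        start c (δ c) (left c) x n eq (left+δ c<m))) (V-period (start + left c)))
      (cong V (linear 3 (λ s c d → [] ⊢ # 1 :+ (s :+ c) :+ d :≡ s :+ (# 1 :+ (c :+ d))) start c
        (δ c)))
      p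

    B≐profiled : B ≐ Profiled profile start
    B≐profiled = to , from
      where
      on : ∀ {c} → c < m → OnProfile profile start c (blockerEdge (start + c))
      on {c} c<m = centred⇒on (blockerEdge (start + c)) c<m (blockerEdge-centred (start + c))
      to : ∀ {e} → B e → Profiled profile start e
      to e∈ with blockerEdge-surjective start e∈
      ... | c , c<m , refl = c , c<m , on c<m
      from : ∀ {e} → Profiled profile start e → B e
      from {e} (c , c<m , p) =
        subst B (joins-unique (blockerEdge (start + c)) e (on c<m) p) (blockerEdge∈ (start + c))

  blocker-profiled : ∃[ s ] ∃[ t ] ∃[ δ ] ∃[ pf ] B ≐ Profiled {t} {δ} pf s
  blocker-profiled with some-zero
  -- The value opposite to a zero is m - 1, so a rise exists within `m` places.
  ... | z , z≡0 with find-rise m m ≤-refl z z≡0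
      (linear 3 (λ a b m → # 1 :+ (a :+ b) :≡ m ∷ b :≡ # 0 ∷ [] ⊢ # 1 :+ a :≡ m) (ε (z + m))
        (ε z) m (ε-antipode z) z≡0)
  ...   | p , l , l≤m , rise with m≤n⇒∃[o]m+o≡n l≤m
  ...     | k , l+k = start , suc k , δ , profile , B≐profiled
    where open FromRise l+k rise

-- The parametrised form of a blocker

%-unique : ∀ n .{{_ : NonZero n}} x y q → + x ≡ + y ℤ.+ q ℤ.* + n → x % n ≡ y % n
%-unique n x y (+ k) eq =
  trans (cong (_% n) (ℤ.+-injective (trans eq (cong (λ z → + y ℤ.+ z) (sym (ℤ.pos-* k n))))))
  ([m+kn]%n≡m%n y k n)
%-unique n x y -[1+ k ] eq = sym
  (%-unique n y x (+ suc k)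
    (trans (move (+ x) (+ y) (+ suc k) (+ n)) (cong (λ z → z ℤ.+ + suc k ℤ.* + n) (sym eq))))
  where
  move : ∀ x y k n → y ≡ (y ℤ.+ (ℤ.- k) ℤ.* n) ℤ.+ k ℤ.* n
  move = solve-∀

%ℕ-+ : ∀ n .{{_ : NonZero n}} a i → (a ℤ.+ + i) %ℕ n ≡ (a %ℕ n + i) % n
%ℕ-+ n a i = trans (sym (m<n⇒m%n≡m (n%ℕd<d (a ℤ.+ + i) n)))
  (%-unique n _ (a %ℕ n + i) (a /ℕ n ℤ.- (a ℤ.+ + i) /ℕ n) (begin
    r                              ≡⟨ cancel r Q N ⟩
    (r ℤ.+ Q ℤ.* N) ℤ.- Q ℤ.* N    ≡⟨ cong (ℤ._- Q ℤ.* N) (a≡a%ℕn+[a/ℕn]*n (a ℤ.+ + i) n) ⟨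
    (a ℤ.+ + i) ℤ.- Q ℤ.* N        ≡⟨ cong (λ z → (z ℤ.+ + i) ℤ.- Q ℤ.* N) (a≡a%ℕn+[a/ℕn]*n a n) ⟩
    ((+ (a %ℕ n) ℤ.+ q ℤ.* N) ℤ.+ + i) ℤ.- Q ℤ.* N ≡⟨ regroup (+ (a %ℕ n)) q N (+ i) Q ⟩
    + (a %ℕ n + i) ℤ.+ (q ℤ.- Q) ℤ.* N ∎))
  where
  open ≡-Reasoning
  r = + ((a ℤ.+ + i) %ℕ n)
  q = a /ℕ n
  Q = (a ℤ.+ + i) /ℕ n
  N = + n
  cancel : ∀ r Q N → r ≡ (r ℤ.+ Q ℤ.* N) ℤ.- Q ℤ.* N
  cancel = solve-∀
  regroup : ∀ A q N i Q → ((A ℤ.+ q ℤ.* N) ℤ.+ i) ℤ.- Q ℤ.* N ≡ (A ℤ.+ i) ℤ.+ (q ℤ.- Q) ℤ.* N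
  regroup = solve-∀

hasSize-resp : ∀ {A : Set} {P Q : Pred A 0ℓ} {k} → P ≐ Q → HasSize Q k → HasSize P k
hasSize-resp (P⊆Q , Q⊆P) (xs , len , u , Q⊆ , ⊆Q) =
  xs , len , u , (λ p → Q⊆ (P⊆Q p)) , (λ x∈ → Q⊆P (⊆Q x∈))

-- `ε` is constrained only at t + 1, ..., m; the first `t` indices are those of the path edges and
-- get radius 0.
legs : ℕ → (ℕ → ℕ) → ℕ → ℕ
legs t ε c with c <? t
... | yes _ = 0
... | no  _ = ε (suc c)

legs-flat : ∀ {t} ε {c} → c < t → legs t ε c ≡ 0
legs-flat {t} ε {c} c<t with c <? t
... | yes _ = refl
... | no c≮t = contradiction c<t c≮t

legs-leg : ∀ {t} ε {c} → t ≤ c → legs t ε c ≡ ε (suc c)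
legs-leg {t} ε {c} t≤c with c <? t
... | yes c<t = contradiction t≤c (<⇒≱ c<t)
... | no _ = refl

-- A strictly increasing sequence of integers grows with slope at least one. Going up to the bound m
-- - 2 at index `m` yields `low`, and coming from the bound 1 at index t + 1 yields `high`.
admissible⇒profile : ∀ {m t ε} → Admissible m t ε → Profile m t (legs t ε)
admissible⇒profile {m} {t} {ε} (2≤t , t≤m , range , rise) = record
  { 2≤t = 2≤t ; t≤m = t≤m ; flat = legs-flat ε
  ; low = low
  ; high = high
  ; incr = incr
  }
  where
  grows : ∀ i {k} → t < k → k + i ≤ m → ε k + i ≤ ε (k + i)
  grows zero {k} _ _ rewrite +-identityʳ k = ≤-reflexive (+-identityʳ (ε k))
  grows (suc i) {k} t<k k≤ rewrite +-suc k i | +-suc (ε k) i =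
    ≤-<-trans (grows i t<k (<⇒≤ k≤)) (rise (k + i) (≤-trans t<k (m≤m+n k i)) k≤)

  low : ∀ {c} → t ≤ c → c < m → legs t ε c < c
  low {c} t≤c c<m rewrite legs-leg ε t≤c with m≤n⇒∃[o]m+o≡n c<m
  ... | i , refl =
        linear 5 (λ c i d e b → d :+ i :≤ e ∷ e :≤ b ∷ # 2 :+ b :≡ # 1 :+ (c :+ i) ∷ [] ⊢ d :< c)
    c i (ε (suc c)) (ε (suc c + i)) (suc (c + i) ∸ 2) (grows i (s≤s t≤c) ≤-refl)
    (proj₂ (range (suc c + i) (s≤s (≤-trans t≤c (m≤m+n c i))) ≤-refl))
    (m+[n∸m]≡n (≤-trans 2≤t t≤m))

  high : ∀ {c} → t ≤ c → c < m → c < t + legs t ε c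
  high {c} t≤c c<m rewrite legs-leg ε t≤c with m≤n⇒∃[o]m+o≡n t≤c
  ... | i , refl = linear 4 (λ t i d e → # 1 :≤ d ∷ d :+ i :≤ e ∷ [] ⊢ t :+ i :< t :+ e) t i
        (ε (suc t)) (ε (suc t + i))
    (proj₁ (range (suc t) ≤-refl (≤-trans (s≤s (m≤m+n t i)) c<m))) (grows i ≤-refl c<m)

  incr : ∀ {c} → t ≤ suc c → suc c < m → legs t ε c < legs t ε (suc c)
  incr {c} t≤ c<m rewrite legs-leg ε t≤ with c <? t
  ... | yes _ = proj₁ (range (suc (suc c)) (s≤s t≤) c<m)
  ... | no c≮t = rise (suc c) (s≤s (≮⇒≥ c≮t)) c<m

profile⇒admissible : ∀ {m t δ} → Profile m t δ → Admissible m t (λ k → δ (pred k))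
profile⇒admissible {m} {t} {δ} pf =
  2≤t , t≤m , range , λ { (suc c) (s≤s t≤c) c<m → incr (m≤n⇒m≤1+n t≤c) c<m }
  where
  open Profile pf
  range : ∀ k → t < k → k ≤ m → 1 ≤ δ (pred k) × δ (pred k) ≤ m ∸ 2
  range (suc c) (s≤s t≤c) c<m =
    linear 3 (λ t c d → t :≤ c ∷ c :< t :+ d ∷ [] ⊢ # 1 :≤ d) t c (δ c) t≤c (high t≤c c<m) ,
    linear 4 (λ c d m b → d :< c ∷ c :< m ∷ # 2 :+ b :≡ m ∷ [] ⊢ d :≤ b) c (δ c) m (m ∸ 2)
      (low t≤c c<m) c<m
      (m+[n∸m]≡n (≤-trans 2≤t t≤m))

module Forms (m : ℕ) .{{_ : NonZero m}} where
  open Polygon m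

  vertex-+ : ∀ a i → vertex m (a ℤ.+ + i) ≡ V (a %ℕ n + i)
  vertex-+ a i = toℕ-injective (trans (toℕ-fromℕ< _) (trans (%ℕ-+ n a i) (sym (toℕ-V _))))

  vertex-%ℕ : ∀ a → vertex m a ≡ V (a %ℕ n)
  vertex-%ℕ a = trans (cong (vertex m) (sym (ℤ.+-identityʳ a)))
    (trans (vertex-+ a 0) (cong V (+-identityʳ _)))

  V-suc : ∀ {i j} → V i ≡ V j → V (suc i) ≡ V (suc j)
  V-suc {i} {j} p = V-cong (trans (%-distribˡ-+ 1 i n)
    (trans (cong (λ z → (1 % n + z) % n) (V-cancel p)) (sym (%-distribˡ-+ 1 j n))))

  -- The hypothesis `base` serves both directions of the equivalence: `s` is `a %ℕ n` when a form is
  -- given, and `a` is `+ s` when it is built from a profile.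
  module _ {t : ℕ} {δ : ℕ → ℕ} (pf : Profile m t δ) (s : ℕ) (a : ℤ)
           (base : ∀ i → vertex m (a ℤ.+ + i) ≡ V (s + i)) where
    open ProfileBounds pf
    open Caterpillar m pf s

    vertex-≡ : ∀ {z i} → z ≡ a ℤ.+ + i → vertex m z ≡ V (s + i)
    vertex-≡ {i = i} refl = base i

    spine-start : ∀ {c} → c < t → vertex m (a ℤ.+ + suc c ℤ.- 1ℤ) ≡ V (s + left c)
    spine-start {c} c<t =
      trans (vertex-≡ (cancel a (+ c))) (cong (λ i → V (s + i)) (sym (left-flat c<t)))
      where
      cancel : ∀ a c → a ℤ.+ (1ℤ ℤ.+ c) ℤ.- 1ℤ ≡ a ℤ.+ c
      cancel = solve-∀

    spine-end : ∀ {c} → c < t → vertex m (a ℤ.+ + suc c) ≡ V (s + right c)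
    spine-end {c} c<t = trans (base (suc c)) (cong (λ i → V (s + i)) (sym (right-flat c<t)))

    leg-start : ∀ {j} → t + j < m →
      vertex m (a ℤ.+ + t ℤ.+ + suc j ℤ.- 1ℤ ℤ.- + δ (t + j)) ≡ V (s + left (t + j))
    leg-start {j} c<m = vertex-≡ (trans (regroup a (+ t) (+ j) (+ δ c))
      (trans (cong (λ z → a ℤ.+ + z ℤ.- + δ c) (sym (left+δ c<m))) (cancel a (+ left c) (+ δ c))))
      where
      c = t + j
      regroup : ∀ a t j d → a ℤ.+ t ℤ.+ (1ℤ ℤ.+ j) ℤ.- 1ℤ ℤ.- d ≡ a ℤ.+ (t ℤ.+ j) ℤ.- d
      regroup = solve-∀
      cancel : ∀ a l d → a ℤ.+ (l ℤ.+ d) ℤ.- d ≡ a ℤ.+ l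
      cancel = solve-∀

    leg-end : ∀ j → vertex m (a ℤ.+ + t ℤ.+ + suc j ℤ.+ + δ (t + j)) ≡ V (s + right (t + j))
    leg-end j = vertex-≡ (regroup a (+ t) (+ j) (+ δ (t + j)))
      where
      regroup : ∀ a t j d → a ℤ.+ t ℤ.+ (1ℤ ℤ.+ j) ℤ.+ d ≡ a ℤ.+ (1ℤ ℤ.+ (t ℤ.+ j ℤ.+ d))
      regroup = solve-∀

    form≐profiled : ∀ {ε} → (∀ {c} → t ≤ c → c < m → ε (suc c) ≡ δ c) →
      (spineEdges m a t U.∪ legEdges m a t ε) ≐ Profiled pf s
    form≐profiled {ε} ε≡ = (λ {e} → to {e}) , λ {e} → from e
      where
      leg≡ : ∀ {j} → t + j < m → ε (t + suc j) ≡ δ (t + j)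
      leg≡ {j} c<m = trans (cong ε (+-suc t j)) (ε≡ (m≤m+n t j) c<m)

      to : ∀ {e} → (spineEdges m a t U.∪ legEdges m a t ε) e → Profiled pf s e
      to {e} (inj₁ (suc c , _ , c<t , p)) = c , <-≤-trans c<t t≤m ,
        subst₂ (Joins e) (spine-start c<t) (spine-end c<t) p
      to {e} (inj₂ (suc j , _ , j< , p)) = t + j , c<m ,
        subst₂ (Joins e) (leg-start c<m) (leg-end j)
          (subst (λ d → Joins e (vertex m (a ℤ.+ + t ℤ.+ + suc j ℤ.- 1ℤ ℤ.- + d))
                                (vertex m (a ℤ.+ + t ℤ.+ + suc j ℤ.+ + d))) (leg≡ c<m) p)
        where
        c<m : t + j < m
        c<m = linear 4 (λ t j m d → t :+ d :≡ m ∷ j :< d ∷ [] ⊢ t :+ j :< m) t j m (m ∸ t)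
          (m+[n∸m]≡n t≤m) j<

      from : ∀ e → Profiled pf s e → (spineEdges m a t U.∪ legEdges m a t ε) e
      from e (c , c<m , p) with c <? t
      ... | yes c<t = inj₁ (suc c , s≤s z≤n , c<t ,
        subst₂ (Joins e) (sym (spine-start c<t)) (sym (spine-end c<t)) p)
      ... | no c≮t with m≤n⇒∃[o]m+o≡n (≮⇒≥ c≮t)
      ...   | j , refl = inj₂ (suc j , s≤s z≤n ,
        linear 4 (λ t j m d → t :+ d :≡ m ∷ t :+ j :< m ∷ [] ⊢ # 1 :+ j :≤ d) t j m (m ∸ t)
          (m+[n∸m]≡n t≤m) c<m ,
        subst (λ d → Joins e (vertex m (a ℤ.+ + t ℤ.+ + suc j ℤ.- 1ℤ ℤ.- + d))
                             (vertex m (a ℤ.+ + t ℤ.+ + suc j ℤ.+ + d))) (sym (leg≡ c<m))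
          (subst₂ (Joins e) (sym (leg-start c<m)) (sym (leg-end j)) p))

    boundaryPath≡spine : ∀ {B : Pred (Edge n) 0ℓ} (B≐ : B ≐ Profiled pf s) →
      boundaryPath m a t ≡ spine B≐
    boundaryPath≡spine B≐ = trans (map-cong base (upTo (suc t))) (map-upTo _ (suc t))

    -- A leg has span 2δ + 1 with 0 < δ and avoids the label 0, so it joins no
    -- two consecutive vertices.
    boundary⇒flat : ∀ e {c} → c < m → OnProfile pf s c e → IsBoundary m e → c < t
    boundary⇒flat e {c} c<m p (i , q) with c <? t
    ... | yes c<t = c<t
    ... | no c≮t = ⊥-elim (absurd (joins-ends e p (subst₂ (Joins e) u≡ v≡ q)))
      where
      k = pos s (vertex m i)
      u≡ : vertex m i ≡ V (s + k)
      u≡ = sym (V-pos s (vertex m i))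
      v≡ : vertex m (i ℤ.+ 1ℤ) ≡ V (s + suc k)
      v≡ = trans (vertex-+ i 1) (trans (cong V (+-comm (i %ℕ n) 1))
        (trans (V-suc {i %ℕ n} {s + k} (trans (sym (vertex-%ℕ i)) u≡))
          (cong V (sym (+-suc s k)))))
      L< = left<n pf s c<m
      R< = right<n pf s c<m
      0<n : 0 < n
      0<n = ≤-<-trans z≤n L<
      -- After the last label 2m - 1 the successor wraps to the label 0.
      next : (suc k < n) ⊎ (V (s + suc k) ≡ V (s + 0))
      next with m≤n⇒m<n∨m≡n (pos<n s (vertex m i))
      ... | inj₁ k+1<n = inj₁ k+1<n
      ... | inj₂ k+1≡n = inj₂ (trans (cong (λ z → V (s + z)) k+1≡n)
                               (trans (V-period s) (cong V (sym (+-identityʳ s)))))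
      absurd : (V (s + left c) ≡ V (s + k) × V (s + right c) ≡ V (s + suc k)) ⊎
               (V (s + left c) ≡ V (s + suc k) × V (s + right c) ≡ V (s + k)) → ⊥
      absurd (inj₁ (l , r)) with next
      ... | inj₂ wrap = contradiction (V-injective s R< 0<n (trans r wrap)) λ ()
      ... | inj₁ k+1<n =
            linear 5 (λ c t d l k → l :≡ k ∷ # 1 :+ (c :+ d) :≡ # 1 :+ k ∷ l :+ d :≡ c ∷ t
              :≤ c ∷ c :< t :+ d ∷ [] ⊢ :⊥)
        c t (δ c) (left c) k (V-injective s L< (pos<n s _) l) (V-injective s R< k+1<n r)
          (left+δ c<m) (≮⇒≥ c≮t) (high (≮⇒≥ c≮t) c<m)
      absurd (inj₂ (l , r)) with next
      ... | inj₂ wrap = <⇒≢ (0<left (≮⇒≥ c≮t) c<m) (sym (V-injective s L< 0<n (trans l wrap)))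
      ... | inj₁ k+1<n = linear 3 (λ l r k → l :≡ # 1 :+ k ∷ r :≡ k ∷ l :< r ∷ [] ⊢ :⊥)
        (left c) (right c) k (V-injective s L< k+1<n l) (V-injective s R< (pos<n s _) r)
          (left<right c<m)

    boundary-size : ∀ {B : Pred (Edge n) 0ℓ} → B ≐ Profiled pf s → HasSize (B ∩ IsBoundary m) t
    boundary-size {B} (B⊆ , ⊆B) = hasSize-resp (to , λ {e} → from e) (initial-size t≤m)
      where
      to : ∀ {e} → (B ∩ IsBoundary m) e → ∃[ c ] c < t × OnProfile pf s c e
      to {e} (e∈ , bd) with B⊆ e∈
      ... | c , c<m , p = c , boundary⇒flat e c<m p bd , p
      from : ∀ e → ∃[ c ] c < t × OnProfile pf s c e → (B ∩ IsBoundary m) e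
      from e (c , c<t , p) = ⊆B (c , <-≤-trans c<t t≤m , p) , a ℤ.+ + c ,
        subst₂ (Joins e)
          (trans (cong (λ i → V (s + i)) (left-flat c<t)) (sym (base c)))
          (trans (cong (λ i → V (s + i)) (right-flat c<t)) (sym (vertex-≡ (regroup a (+ c)))))
          p
        where
        regroup : ∀ a c → a ℤ.+ c ℤ.+ 1ℤ ≡ a ℤ.+ (1ℤ ℤ.+ c)
        regroup = solve-∀

  form⇒profiled : ∀ {B} a {t ε} (form : HasForm m B a t ε) →
    B ≐ Profiled (admissible⇒profile (proj₁ form)) (a %ℕ n)
  form⇒profiled a {ε = ε} (adm , B⊆ , ⊆B) =
    (λ {e} e∈ → proj₁ eq {e} (B⊆ e∈)) , (λ {e} e∈ → ⊆B (proj₂ eq {e} e∈))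
    where
    eq = form≐profiled (admissible⇒profile adm) (a %ℕ n) a (vertex-+ a) {ε}
      (λ t≤c _ → sym (legs-leg ε t≤c))

  profiled⇒form : ∀ {B t δ} (pf : Profile m t δ) s → B ≐ Profiled pf s →
    HasForm m B (+ s) t (λ k → δ (pred k))
  profiled⇒form {δ = δ} pf s (B⊆ , ⊆B) = profile⇒admissible pf ,
    (λ {e} e∈ → proj₂ eq {e} (B⊆ e∈)) , (λ {e} e∈ → ⊆B (proj₁ eq {e} e∈))
    where
    base : ∀ i → vertex m (+ s ℤ.+ + i) ≡ V (s + i)
    base i = trans (vertex-%ℕ (+ (s + i))) (V-cong {(s + i) % n} {s + i} (m%n%n≡m%n (s + i) n))
    eq = form≐profiled pf s (+ s) base {λ k → δ (pred k)} (λ _ _ → refl)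

  profiled⇒blocker : ∀ {B t δ} (pf : Profile m t δ) s → B ≐ Profiled pf s → IsBlocker m B
  profiled⇒blocker pf s B≐ =
    (λ M spm → let e , e∈ , e∈M = profiled-blocking pf s M spm in e , proj₂ B≐ e∈ , e∈M) ,
    hasSize-resp B≐ (Caterpillar.profiled-size m pf s)

theorem1 : (m : ℕ) .{{_ : NonZero m}} → 2 ≤ m →
    (B : Pred (Edge (2 * m)) 0ℓ) →
    (IsBlocker m B ⇔ (∃[ a ] ∃[ t ] ∃[ ε ] HasForm m B a t ε)) ×
    (IsBlocker m B →
    CrossingFree B × IsCaterpillar ⟦ B ⟧ ×
    (∀ a t ε → HasForm m B a t ε →
    IsSpine ⟦ B ⟧ (boundaryPath m a t) ×
    pathLength (boundaryPath m a t) ≡ t ×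
    2 ≤ t ×
    HasSize (B ∩ IsBoundary m) t))
theorem1 m 2≤m B =
  mk⇔ (λ blocker → let s , t , δ , pf , B≐ = Blocker.blocker-profiled m 2≤m B blocker in
         + s , t , (λ k → δ (pred k)) , profiled⇒form pf s B≐)
      (λ (a , t , ε , form) →
         profiled⇒blocker (admissible⇒profile (proj₁ form)) (a %ℕ n) (form⇒profiled a form)) ,
  λ blocker → let s , t , δ , pf , B≐ = Blocker.blocker-profiled m 2≤m B blocker in
    Caterpillar.crossing-free m pf s B≐ ,
    Caterpillar.caterpillar m pf s B≐ ,
    λ a t ε form → details a t form
  where
  open Forms m
  open Polygon m
  details : ∀ a t {ε} → HasForm m B a t ε →
    IsSpine ⟦ B ⟧ (boundaryPath m a t) × pathLength (boundaryPath m a t) ≡ t × 2 ≤ t ×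
    HasSize (B ∩ IsBoundary m) t
  details a t form =
    proj₁ on-path , proj₂ on-path , proj₁ (proj₁ form) , boundary-size pf (a %ℕ n) a (vertex-+ a) B≐
    where
    -- The claims concern every form of `B`, so the profile comes from the given form and not from
    -- the one found for the blocker.
    pf = admissible⇒profile (proj₁ form)
    B≐ = form⇒profiled a form
    open Caterpillar m pf (a %ℕ n)
    on-path : IsSpine ⟦ B ⟧ (boundaryPath m a t) × pathLength (boundaryPath m a t) ≡ t
    on-path = subst (λ vs → IsSpine ⟦ B ⟧ vs × pathLength vs ≡ t)
      (sym (boundaryPath≡spine pf (a %ℕ n) a (vertex-+ a) B≐))
      ((spine-path B≐ , λ ws path →
          subst (pathLength ws ≤_) (sym (spine-length B≐)) (path-length≤ B≐ ws path)) ,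
       spine-length B≐)
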